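{- Let $G \in \widetilde{\mathbb{G}}$ and suppose that $G$ is not equal to any integer. Let $a<b$ be in $\mathbb{Z}[\frac12]$; below $t$ ranges over $\mathbb{Z}[\frac12]$. 1. If $\widetilde{\lambda}_t(G)$ is constant for $t \in (a,b]$, then for each $t \in (a,b]$, $(G^L)_t-t \lhd\!| \widetilde{\lambda}_t(G)$ for every Left option $G^L$ of $G$. 2. If $\widetilde{\rho}_t(G)$ is constant for $t \in (a,b]$, then for each $t \in (a,b]$, $\widetilde{\rho}_t(G) \lhd\!| (G^R)_t+t$ for every Right option $G^R$ of $G$. 3. If $\widetilde{\lambda}_t(G)$ is strictly decreasing for $t \in (a,b]$, then for each $t \in (a,b]$ there exists a Left option $G^L$ of $G$ such that $(G^L)_t-t \geq \widetilde{\lambda}_t(G)$. 4. If $\widetilde{\rho}_t(G)$ is strictly increasing for $t \in (a,b]$, then for each $t \in (a,b]$ there exists a Right option $G^R$ of $G$ such that $\widetilde{\rho}_t(G) \geq (G^R)_t+t$.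
   Context: Games. $\widetilde{\mathbb{G}}$ is the set of all formal (short, i.e. finite loopfree) normal-play partizan games $G=\{G^L\mid G^R\}$, where $G^L$ (resp. $G^R$) ranges over the finitely many Left (resp. Right) options of $G$; $\tilde b(G)$ is the formal birthday (height of the game tree). Sums and negatives of games are the usual ones; $G\ge 0$ means Left wins $G$ moving second under normal play, $G\ge H$ means $G-H\ge 0$, and $G$ is equal to $H$ (equality of game values) if $G\ge H$ and $H\ge G$. $G\lhd\!| H$ means $G\not\ge H$. The dyadic rationals $\mathbb{Z}[\frac12]$ are identified in the usual way with the numbers among game values; "equal to an integer/number" means having such a game value. When a dyadic rational is used as a formal game, its canonical form is meant. Cooling and temperature. For $G\in\widetilde{\mathbb{G}}$ and $t\in\mathbb{Z}[\frac12]$, define $\lambda_t(G),\rho_t(G)\in\mathbb{Z}[\frac12]$, $G_t\in\widetilde{\mathbb{G}}$ and $t(G)\in\mathbb{Z}[\frac12]\cup\{ -\infty\}$ by recursion on $\tilde b(G)$ (this recursion is well-defined): - If $G$ is equal to an integer $n$: $\lambda_t(G)=\rho_t(G)=n$, $G_t=n$ (canonical form), $t(G)=-\infty$. - Otherwise let $\widetilde{\lambda}_t(G)=\max_{G^L}\{\rho_t(G^L)-t\}$, $\widetilde{\rho}_t(G)=\min_{G^R}\{\lambda_t(G^R)+t\}$, $\widetilde{G}_t=\{(G^L)_t-t\mid (G^R)_t+t\}$ (with all $G^L$, $G^R$), and $t(G)=\min\{t\in\mathbb{Z}[\frac12]\mid \widetilde{\lambda}_t(G)=\widetilde{\rho}_t(G)\}$.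 If $t\le t(G)$, set $\lambda_t(G)=\widetilde{\lambda}_t(G)$, $\rho_t(G)=\widetilde{\rho}_t(G)$, $G_t=\widetilde{G}_t$. If $t>t(G)$, set $\lambda_t(G)=\rho_t(G)=x$ and $G_t=x$ (canonical form), where $x=\lambda_{t(G)}(G)=\rho_{t(G)}(G)$. -}

module Defs where

open import Data.Empty using (⊥)
open import Data.Fin.Base using (Fin; zero; suc; toℕ; fromℕ<; _↑ˡ_; _↑ʳ_; splitAt)
open import Data.Fin.Properties using (all?; any?; splitAt-↑ˡ; splitAt-↑ʳ; toℕ-fromℕ<)
open import Data.Integer.Base as ℤ using (ℤ; +_; -[1+_])
import Data.Integer.Properties as ℤₚ
open import Data.Integer.Tactic.RingSolver using (solve-∀)
open import Data.Maybe.Base using (Maybe; just; nothing)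
open import Data.Nat.Base as ℕ using (ℕ; zero; suc)
open import Data.Nat.Coprimality as C using (1-coprimeTo)
open import Data.Nat.Logarithm using (⌊log₂_⌋; ⌊log₂[2^n]⌋≡n)
open import Data.Nat.Divisibility as ∣ using (_∣_; divides)
open import Data.Nat.Primality using (euclidsLemma; prime[2])
import Data.Nat.Properties as ℕₚ
open import Data.Product using (∃; _×_; _,_; proj₁; proj₂)
open import Data.Rational.Base as ℚ using (ℚ; 0ℚ; ↥_; ↧_; ↧ₙ_; mkℚ)
open import Data.Rational.Literals using (fromℤ)
import Data.Rational.Properties as ℚₚ
import Data.Rational.Unnormalised.Base as ℚᵘ
import Data.Rational.Unnormalised.Properties as ℚᵘₚ
open import Data.Sum.Base using (_⊎_; inj₁; inj₂; [_,_])
open import Data.Vec.Functional using (_++_; foldr)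
open import Function.Base using (_∘_)
open import Relation.Binary.PropositionalEquality hiding ([_])
open import Level using (0ℓ)
import Tactic.RingSolver as RingSolver
open import Tactic.RingSolver.Core.AlmostCommutativeRing using (AlmostCommutativeRing; fromCommutativeRing)
open import Relation.Nullary.Decidable using (dec⇒maybe; Dec; yes; no; recompute; _×-dec_; _⊎-dec_)
open import Relation.Nullary.Negation using (¬_; contradiction)

-- A rational is stored in lowest terms, so _≡_ is equality of dyadic rationals (≡-value).
record ℤ[½] : Set where
  constructor dyadic
  field
    value           : ℚ
    exponent        : ℕ
    .denominator≡2^ : ↧ₙ value ≡ 2 ℕ.^ exponent

open ℤ[½]

denom : ∀ z → ↧ₙ (value z) ≡ 2 ℕ.^ exponent z
denom (dyadic _ _ d) = recompute (_ ℕₚ.≟ _) d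

2^-injective : ∀ {m n} → 2 ℕ.^ m ≡ 2 ℕ.^ n → m ≡ n
2^-injective {m} {n} eq =
  trans (sym (⌊log₂[2^n]⌋≡n m)) (trans (cong ⌊log₂_⌋ eq) (⌊log₂[2^n]⌋≡n n))

≡-value : ∀ x y → value x ≡ value y → x ≡ y
≡-value x@(dyadic v m _) y@(dyadic _ n _) refl with 2^-injective {m} {n} (trans (sym (denom x)) (denom y))
... | refl = refl

pow-divisor : ∀ m {d} → d ∣ 2 ℕ.^ m → ∃ λ k → k ℕ.≤ m × d ≡ 2 ℕ.^ k
pow-divisor zero d∣1 = 0 , ℕ.z≤n , ∣.∣1⇒≡1 d∣1
pow-divisor (suc m) {d} (divides q eq)
  with euclidsLemma q d prime[2] (subst (2 ∣_) eq (∣.m∣m*n (2 ℕ.^ m)))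
... | inj₁ (divides q′ refl) =
  let k , k≤m , d≡ = pow-divisor m (divides q′ (ℕₚ.*-cancelˡ-≡ _ _ 2
        (trans eq (trans (cong (ℕ._* d) (ℕₚ.*-comm q′ 2)) (ℕₚ.*-assoc 2 q′ d)))))
  in k , ℕₚ.m≤n⇒m≤1+n k≤m , d≡
... | inj₂ (divides d′ refl) =
  let k , k≤m , d≡ = pow-divisor m {d′} (divides q (ℕₚ.*-cancelˡ-≡ _ _ 2
        (trans eq (trans (sym (ℕₚ.*-assoc q d′ 2)) (ℕₚ.*-comm (q ℕ.* d′) 2)))))
  in suc k , ℕ.s≤s k≤m , trans (ℕₚ.*-comm d′ 2) (cong (2 ℕ.*_) d≡)

+-denominator : ∀ p q a b → ↧ₙ p ≡ 2 ℕ.^ a → ↧ₙ q ≡ 2 ℕ.^ b → ↧ₙ (p ℚ.+ q) ∣ 2 ℕ.^ (a ℕ.⊔ b)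
+-denominator p q a b p≡ q≡ = coprimality (p ℚ.+ q) {M} {N} eq₃
  where
  m = a ℕ.⊔ b
  M P Q u v : ℕ
  M = 2 ℕ.^ m
  P = 2 ℕ.^ a
  Q = 2 ℕ.^ b
  u = 2 ℕ.^ (m ℕ.∸ a)
  v = 2 ℕ.^ (m ℕ.∸ b)
  uP : u ℕ.* P ≡ M
  uP = trans (sym (ℕₚ.^-distribˡ-+-* 2 (m ℕ.∸ a) a)) (cong (2 ℕ.^_) (ℕₚ.m∸n+n≡m (ℕₚ.m≤m⊔n a b)))
  vQ : v ℕ.* Q ≡ M
  vQ = trans (sym (ℕₚ.^-distribˡ-+-* 2 (m ℕ.∸ b) b)) (cong (2 ℕ.^_) (ℕₚ.m∸n+n≡m (ℕₚ.m≤n⊔m a b)))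
  N : ℤ
  N = ↥ p ℤ.* + u ℤ.+ ↥ q ℤ.* + v
  R r : ℤ
  R = ↥ (p ℚ.+ q)
  r = ↧ (p ℚ.+ q)
  eq₁ : ∀ p q → ↥ (p ℚ.+ q) ℤ.* (↧ p ℤ.* ↧ q) ≡ (↥ p ℤ.* ↧ q ℤ.+ ↥ q ℤ.* ↧ p) ℤ.* ↧ (p ℚ.+ q)
  eq₁ p@(mkℚ _ _ _) q@(mkℚ _ _ _) with p ℚ.+ q | ℚₚ.toℚᵘ-homo-+ p q
  ... | mkℚ _ _ _ | ℚᵘ.*≡* e = e
  eq₂ : R ℤ.* (+ P ℤ.* + Q) ≡ (↥ p ℤ.* + Q ℤ.+ ↥ q ℤ.* + P) ℤ.* r
  eq₂ = subst₂ (λ x y → R ℤ.* (+ x ℤ.* + y) ≡ (↥ p ℤ.* + y ℤ.+ ↥ q ℤ.* + x) ℤ.* r) p≡ q≡ (eq₁ p q)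
  shuffle₁ : ∀ R P Q u v → R ℤ.* (u ℤ.* P) ℤ.* (v ℤ.* Q) ≡ R ℤ.* (P ℤ.* Q) ℤ.* (u ℤ.* v)
  shuffle₁ = solve-∀
  shuffle₂ : ∀ x y P Q r u v → (x ℤ.* Q ℤ.+ y ℤ.* P) ℤ.* r ℤ.* (u ℤ.* v)
    ≡ x ℤ.* u ℤ.* r ℤ.* (v ℤ.* Q) ℤ.+ y ℤ.* v ℤ.* r ℤ.* (u ℤ.* P)
  shuffle₂ = solve-∀
  shuffle₃ : ∀ x y r u v M → x ℤ.* u ℤ.* r ℤ.* M ℤ.+ y ℤ.* v ℤ.* r ℤ.* M
    ≡ (x ℤ.* u ℤ.+ y ℤ.* v) ℤ.* r ℤ.* M
  shuffle₃ = solve-∀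
  uP′ : + u ℤ.* + P ≡ + M
  uP′ = trans (sym (ℤₚ.pos-* u P)) (cong +_ uP)
  vQ′ : + v ℤ.* + Q ≡ + M
  vQ′ = trans (sym (ℤₚ.pos-* v Q)) (cong +_ vQ)
  eq₃ : R ℤ.* + M ≡ N ℤ.* r
  eq₃ = ℤₚ.*-cancelʳ-≡ _ _ (+ M) {{ℕ.>-nonZero (ℕₚ.m^n>0 2 m)}} (begin
    R ℤ.* + M ℤ.* + M                       ≡⟨ cong₂ (λ x y → R ℤ.* x ℤ.* y) uP′ vQ′ ⟨
    R ℤ.* (+ u ℤ.* + P) ℤ.* (+ v ℤ.* + Q)   ≡⟨ shuffle₁ R (+ P) (+ Q) (+ u) (+ v) ⟩
    R ℤ.* (+ P ℤ.* + Q) ℤ.* (+ u ℤ.* + v)   ≡⟨ cong (ℤ._* (+ u ℤ.* + v)) eq₂ ⟩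
    (↥ p ℤ.* + Q ℤ.+ ↥ q ℤ.* + P) ℤ.* r ℤ.* (+ u ℤ.* + v)
      ≡⟨ shuffle₂ (↥ p) (↥ q) (+ P) (+ Q) r (+ u) (+ v) ⟩
    ↥ p ℤ.* + u ℤ.* r ℤ.* (+ v ℤ.* + Q) ℤ.+ ↥ q ℤ.* + v ℤ.* r ℤ.* (+ u ℤ.* + P)
      ≡⟨ cong₂ (λ x y → ↥ p ℤ.* + u ℤ.* r ℤ.* x ℤ.+ ↥ q ℤ.* + v ℤ.* r ℤ.* y) vQ′ uP′ ⟩
    ↥ p ℤ.* + u ℤ.* r ℤ.* + M ℤ.+ ↥ q ℤ.* + v ℤ.* r ℤ.* + M
      ≡⟨ shuffle₃ (↥ p) (↥ q) r (+ u) (+ v) (+ M) ⟩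
    N ℤ.* r ℤ.* + M ∎)
    where open ≡-Reasoning
  coprimality : ∀ x {i j} → ↥ x ℤ.* + i ≡ j ℤ.* ↧ x → ↧ₙ x ∣ i
  coprimality (mkℚ n d c) {i} {j} eq = C.coprime-divisor (C.sym (C.recompute c))
    (divides ℤ.∣ j ∣ (trans (sym (ℤₚ.abs-* n (+ i))) (trans (cong ℤ.∣_∣ eq) (ℤₚ.abs-* j (+ suc d)))))

infixl 6 _+_ _-_
infix  8 -_
infix  4 _≤_ _<_ _≤?_

+-exponent : ∀ x y → ∃ λ k → k ℕ.≤ exponent x ℕ.⊔ exponent y × ↧ₙ (value x ℚ.+ value y) ≡ 2 ℕ.^ k
+-exponent x y = pow-divisor (exponent x ℕ.⊔ exponent y)
  (+-denominator (value x) (value y) (exponent x) (exponent y) (denom x) (denom y))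

log₂-exact : ∀ {d k} → d ≡ 2 ℕ.^ k → k ≡ ⌊log₂ d ⌋
log₂-exact {k = k} refl = sym (⌊log₂[2^n]⌋≡n k)

abstract
  +-denominator≡2^ : ∀ x y → let q = value x ℚ.+ value y in ↧ₙ q ≡ 2 ℕ.^ ⌊log₂ ↧ₙ q ⌋
  +-denominator≡2^ x y = let k , _ , eq = +-exponent x y in
    trans eq (cong (2 ℕ.^_) (log₂-exact {k = k} eq))

  neg-denominator≡2^ : ∀ x → ↧ₙ (ℚ.- value x) ≡ 2 ℕ.^ exponent x
  neg-denominator≡2^ x = trans (cong ℤ.∣_∣ (ℚₚ.↧-neg (value x))) (denom x)

_+_ : ℤ[½] → ℤ[½] → ℤ[½]
x + y = let q = value x ℚ.+ value y in dyadic q ⌊log₂ ↧ₙ q ⌋ (+-denominator≡2^ x y)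

-_ : ℤ[½] → ℤ[½]
- x = dyadic (ℚ.- value x) (exponent x) (neg-denominator≡2^ x)

_-_ : ℤ[½] → ℤ[½] → ℤ[½]
x - y = x + (- y)

fromInt : ℤ → ℤ[½]
fromInt z = dyadic (fromℤ z) 0 refl

_≤_ _<_ : ℤ[½] → ℤ[½] → Set
x ≤ y = value x ℚ.≤ value y
x < y = value x ℚ.< value y

_≤?_ : ∀ x y → Dec (x ≤ y)
x ≤? y = value x ℚₚ.≤? value y

exponent-+ : ∀ x y → exponent (x + y) ℕ.≤ exponent x ℕ.⊔ exponent y
exponent-+ x y = let k , k≤ , eq = +-exponent x y in subst (ℕ._≤ exponent x ℕ.⊔ exponent y) (log₂-exact {k = k} eq) k≤

unitFraction : ∀ d → .{{ℕ.NonZero d}} → ℚ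
unitFraction d = ℚ.mkℚ+ 1 d (1-coprimeTo d)

abstract
  unitFraction-denominator : ∀ n → ↧ₙ (unitFraction (2 ℕ.^ n) {{ℕₚ.m^n≢0 2 n}}) ≡ 2 ℕ.^ n
  unitFraction-denominator n = cong ℤ.∣_∣ (ℚₚ.↧-mkℚ+ 1 (2 ℕ.^ n) {{ℕₚ.m^n≢0 2 n}})

1/2^ : ℕ → ℤ[½]
1/2^ n = dyadic (unitFraction (2 ℕ.^ n) {{ℕₚ.m^n≢0 2 n}}) n (unitFraction-denominator n)

1/2^-half : ∀ n → value (1/2^ (suc n)) ℚ.+ value (1/2^ (suc n)) ≡ value (1/2^ n)
1/2^-half n = half (2 ℕ.^ n) {{ℕₚ.m^n≢0 2 n}} {{ℕₚ.m^n≢0 2 (suc n)}}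
  where
  ring : ∀ D → (+ 1 ℤ.* (+ 2 ℤ.* D) ℤ.+ + 1 ℤ.* (+ 2 ℤ.* D)) ℤ.* D
    ≡ + 1 ℤ.* ((+ 2 ℤ.* D) ℤ.* (+ 2 ℤ.* D))
  ring = solve-∀
  half : ∀ d .{{_ : ℕ.NonZero d}} .{{_ : ℕ.NonZero (2 ℕ.* d)}} →
    unitFraction (2 ℕ.* d) ℚ.+ unitFraction (2 ℕ.* d) ≡ unitFraction d
  half (suc d) = ℚₚ.toℚᵘ-injective (ℚᵘₚ.≃-trans (ℚₚ.toℚᵘ-homo-+ p p) (ℚᵘ.*≡* eq))
    where
    p = unitFraction (2 ℕ.* suc d)
    eq = subst (λ z → (+ 1 ℤ.* z ℤ.+ + 1 ℤ.* z) ℤ.* + suc d ≡ + 1 ℤ.* (z ℤ.* z))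
      (sym (ℤₚ.pos-* 2 (suc d))) (ring (+ suc d))

1/2^-gap : ∀ n x → exponent x ℕ.≤ n → 0ℚ ℚ.< value x → value (1/2^ n) ℚ.≤ value x
1/2^-gap n x@(dyadic (mkℚ (+ suc k) d c) e _) e≤n _ = go
  where
  le : 1 ℕ.* suc d ℕ.≤ suc k ℕ.* 2 ℕ.^ n
  le = ℕₚ.*-mono-≤ {1} {suc k} {suc d} (ℕ.s≤s ℕ.z≤n) (ℕₚ.≤-trans (ℕₚ.≤-reflexive (denom x)) (ℕₚ.^-monoʳ-≤ 2 e≤n))
  go : value (1/2^ n) ℚ.≤ mkℚ (+ suc k) d c
  go with 2 ℕ.^ n | ℕₚ.m^n≢0 2 n | le
  ... | suc m | _ | le = ℚ.*≤* (subst₂ ℤ._≤_ (ℤₚ.pos-* 1 (suc d)) (ℤₚ.pos-* (suc k) (suc m)) (ℤ.+≤+ le))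
1/2^-gap n (dyadic (mkℚ (+ zero) d c) e _) e≤n (ℚ.*<* (ℤ.+<+ ()))
1/2^-gap n (dyadic (mkℚ -[1+ k ] d c) e _) e≤n (ℚ.*<* ())

infixl 6 _⊔_ _⊓_

_⊔_ _⊓_ : ℤ[½] → ℤ[½] → ℤ[½]
x ⊔ y with x ≤? y
... | yes _ = y
... | no  _ = x
x ⊓ y with x ≤? y
... | yes _ = x
... | no  _ = y

-- Options are finite families rather than finite sets: repeated options are allowed, and no
-- notion below can tell the difference.
data Game : Set where
  game : ∀ {m n} → (Fin m → Game) → (Fin n → Game) → Game

LeftOption RightOption : Game → Set
LeftOption  (game {m} {_} _ _) = Fin m
RightOption (game {_} {n} _ _) = Fin n

left : (G : Game) → LeftOption G → Game
left (game L _) = L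

right : (G : Game) → RightOption G → Game
right (game _ R) = R

birthday : Game → ℕ
birthday (game L R) =
  foldr ℕ._⊔_ 0 (λ i → suc (birthday (L i))) ℕ.⊔ foldr ℕ._⊔_ 0 (λ j → suc (birthday (R j)))

infixl 6 _⊕_ _⊖_
infix  8 ⊝_
infix  4 _≥ᴳ_ _⊲∣_ _≈ᴳ_

_⊕_ : Game → Game → Game
G@(game L R) ⊕ H@(game L′ R′) =
  game ((λ i → L i ⊕ H) ++ (λ i → G ⊕ L′ i)) ((λ j → R j ⊕ H) ++ (λ j → G ⊕ R′ j))

⊝_ : Game → Game
⊝ game L R = game (λ j → ⊝ R j) (λ i → ⊝ L i)

_⊖_ : Game → Game → Game
G ⊖ H = G ⊕ (⊝ H)

-- Normal play: the player with no move loses.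
mutual
  LeftWinsMovingFirst : Game → Set
  LeftWinsMovingFirst (game L R) = ∃ λ i → LeftWinsMovingSecond (L i)

  LeftWinsMovingSecond : Game → Set
  LeftWinsMovingSecond (game L R) = ∀ j → LeftWinsMovingFirst (R j)

_≥ᴳ_ _⊲∣_ _≈ᴳ_ : Game → Game → Set
G ≥ᴳ H = LeftWinsMovingSecond (G ⊖ H)
G ⊲∣ H = ¬ G ≥ᴳ H
G ≈ᴳ H = G ≥ᴳ H × H ≥ᴳ G

natural : ℕ → Game
natural zero    = game {0} {0} (λ ()) (λ ())
natural (suc n) = game {1} {0} (λ _ → natural n) (λ ())

integer : ℤ → Game
integer (+ n)    = natural n
integer -[1+ n ] = ⊝ natural (suc n)

IsInteger : Game → Set
IsInteger G = ∃ λ n → G ≈ᴳ integer n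

infix 4 _▷_ _≥ᴳ?_ _≈ᴳ?_

_▷_ : Game → Game → Set
G ▷ H = LeftWinsMovingFirst (G ⊖ H)

module _ {a p} {A : Set a} {P : A → Set p} where
  ++-∀ : ∀ {m n} (f : Fin m → A) (g : Fin n → A) →
    (∀ i → P (f i)) → (∀ j → P (g j)) → ∀ k → P ((f ++ g) k)
  ++-∀ {m} f g pf pg k with splitAt m k
  ... | inj₁ i = pf i
  ... | inj₂ j = pg j

  ++-∀ˡ : ∀ {m n} (f : Fin m → A) (g : Fin n → A) → (∀ k → P ((f ++ g) k)) → ∀ i → P (f i)
  ++-∀ˡ {m} {n} f g h i with h (i ↑ˡ n)
  ... | p rewrite splitAt-↑ˡ m i n = p

  ++-∀ʳ : ∀ {m n} (f : Fin m → A) (g : Fin n → A) → (∀ k → P ((f ++ g) k)) → ∀ j → P (g j)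
  ++-∀ʳ {m} {n} f g h j with h (m ↑ʳ j)
  ... | p rewrite splitAt-↑ʳ m n j = p

  ++-∃ˡ : ∀ {m n} (f : Fin m → A) (g : Fin n → A) → ∀ i → P (f i) → ∃ λ k → P ((f ++ g) k)
  ++-∃ˡ {m} {n} f g i p = i ↑ˡ n , subst (λ s → P ([ f , g ] s)) (sym (splitAt-↑ˡ m i n)) p

  ++-∃ʳ : ∀ {m n} (f : Fin m → A) (g : Fin n → A) → ∀ j → P (g j) → ∃ λ k → P ((f ++ g) k)
  ++-∃ʳ {m} {n} f g j p = m ↑ʳ j , subst (λ s → P ([ f , g ] s)) (sym (splitAt-↑ʳ m n j)) p

  ++-∃ : ∀ {m n} (f : Fin m → A) (g : Fin n → A) → (∃ λ k → P ((f ++ g) k)) →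
    (∃ λ i → P (f i)) ⊎ (∃ λ j → P (g j))
  ++-∃ {m} f g (k , p) with splitAt m k
  ... | inj₁ i = inj₁ (i , p)
  ... | inj₂ j = inj₂ (j , p)

≥-intro : ∀ G H → (∀ j → right G j ▷ H) → (∀ i → G ▷ left H i) → G ≥ᴳ H
≥-intro G@(game L R) H@(game L′ R′) p q = ++-∀ {P = LeftWinsMovingFirst} (λ j → R j ⊖ H) (λ i → G ⊖ L′ i) p q

≥-right : ∀ G H → G ≥ᴳ H → ∀ j → right G j ▷ H
≥-right G@(game L R) H@(game L′ R′) = ++-∀ˡ {P = LeftWinsMovingFirst} (λ j → R j ⊖ H) (λ i → G ⊖ L′ i)

≥-left : ∀ G H → G ≥ᴳ H → ∀ i → G ▷ left H i
≥-left G@(game L R) H@(game L′ R′) = ++-∀ʳ {P = LeftWinsMovingFirst} (λ j → R j ⊖ H) (λ i → G ⊖ L′ i)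

▷-left : ∀ G H i → left G i ≥ᴳ H → G ▷ H
▷-left G@(game L R) H@(game L′ R′) = ++-∃ˡ {P = LeftWinsMovingSecond} (λ i → L i ⊖ H) (λ j → G ⊖ R′ j)

▷-right : ∀ G H j → G ≥ᴳ right H j → G ▷ H
▷-right G@(game L R) H@(game L′ R′) = ++-∃ʳ {P = LeftWinsMovingSecond} (λ i → L i ⊖ H) (λ j → G ⊖ R′ j)

▷-elim : ∀ G H → G ▷ H → (∃ λ i → left G i ≥ᴳ H) ⊎ (∃ λ j → G ≥ᴳ right H j)
▷-elim G@(game L R) H@(game L′ R′) = ++-∃ {P = LeftWinsMovingSecond} (λ i → L i ⊖ H) (λ j → G ⊖ R′ j)

mutual
  first? : ∀ G → Dec (LeftWinsMovingFirst G)
  first? (game L R) = any? (λ i → second? (L i))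

  second? : ∀ G → Dec (LeftWinsMovingSecond G)
  second? (game L R) = all? (λ j → first? (R j))

≥⇒⋫ : ∀ G H → G ≥ᴳ H → ¬ H ▷ G
≥⇒⋫ G@(game L R) H@(game L′ R′) G≥H H▷G =
  [ (λ (i , p) → ≥⇒⋫ (L′ i) G p (≥-left G H G≥H i))
  , (λ (j , p) → ≥⇒⋫ H (R j) p (≥-right G H G≥H j)) ] (▷-elim H G H▷G)

mutual
  ≱⇒▷ : ∀ G H → ¬ G ≥ᴳ H → H ▷ G
  ≱⇒▷ G H G≱H with first? (H ⊖ G)
  ... | yes p = p
  ... | no ¬p = contradiction (⋫⇒≥ G H ¬p) G≱H

  ⋫⇒≥ : ∀ G H → ¬ H ▷ G → G ≥ᴳ H
  ⋫⇒≥ G@(game L R) H@(game L′ R′) ¬p = ≥-intro G H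
    (λ j → ≱⇒▷ H (R j) (λ q → ¬p (▷-right H G j q)))
    (λ i → ≱⇒▷ (L′ i) G (λ q → ¬p (▷-left H G i q)))

≥-refl : ∀ G → G ≥ᴳ G
≥-refl G@(game L R) = ≥-intro G G (λ j → ▷-right (R j) G j (≥-refl (R j))) (λ i → ▷-left G (L i) i (≥-refl (L i)))

≥-trans : ∀ G H K → G ≥ᴳ H → H ≥ᴳ K → G ≥ᴳ K
≥-trans G@(game L R) H@(game _ _) K@(game L″ R″) G≥H H≥K = ≥-intro G K
  (λ j → ≱⇒▷ K (R j) (λ K≥Rj → ≥⇒⋫ H (R j) (≥-trans H K (R j) H≥K K≥Rj) (≥-right G H G≥H j)))
  (λ i → ≱⇒▷ (L″ i) G (λ Li≥G → ≥⇒⋫ (L″ i) H (≥-trans (L″ i) G H Li≥G G≥H) (≥-left H K H≥K i)))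

≥-suc : ∀ z → integer (ℤ.suc z) ≥ᴳ integer z
≥-suc (+ zero) = ≥-intro (natural 1) (natural 0) (λ ()) (λ ())
≥-suc (+ suc n) = ≥-intro (natural (suc (suc n))) (natural (suc n)) (λ ())
  (λ _ → ▷-left (natural (suc (suc n))) (natural n) zero (≥-suc (+ n)))
≥-suc -[1+ zero ] = ≥-intro (natural 0) (⊝ natural 1) (λ ()) (λ ())
≥-suc -[1+ suc zero ] = ≥-intro (⊝ natural 1) (⊝ natural 2)
  (λ _ → ▷-right (⊝ natural 0) (⊝ natural 2) zero (≥-intro (⊝ natural 0) (⊝ natural 1) (λ ()) (λ ()))) (λ ())
≥-suc -[1+ suc (suc n) ] = ≥-intro (⊝ natural (suc (suc n))) (⊝ natural (suc (suc (suc n))))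
  (λ _ → ▷-right (⊝ natural (suc n)) (⊝ natural (suc (suc (suc n)))) zero (≥-suc -[1+ suc n ])) (λ ())

suc-▷ : ∀ z → integer (ℤ.suc z) ▷ integer z
suc-▷ (+ n) = ▷-left (natural (suc n)) (natural n) zero (≥-refl (natural n))
suc-▷ -[1+ zero ] = ▷-right (natural 0) (⊝ natural 1) zero (≥-intro (natural 0) (⊝ natural 0) (λ ()) (λ ()))
suc-▷ -[1+ suc n ] = ▷-right (⊝ natural (suc n)) (⊝ natural (suc (suc n))) zero (≥-refl (⊝ natural (suc n)))

≥-+ : ∀ k z → integer (+ k ℤ.+ z) ≥ᴳ integer z
≥-+ zero z rewrite ℤₚ.+-identityˡ z = ≥-refl (integer z)
≥-+ (suc k) z rewrite ℤₚ.suc-+ k z =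
  ≥-trans (integer (ℤ.suc (+ k ℤ.+ z))) (integer (+ k ℤ.+ z)) (integer z) (≥-suc (+ k ℤ.+ z)) (≥-+ k z)

integer-mono : ∀ {m n} → m ℤ.≤ n → integer n ≥ᴳ integer m
integer-mono {m} {n} m≤n = subst (λ z → integer z ≥ᴳ integer m) eq (≥-+ ℤ.∣ n ℤ.- m ∣ m)
  where
  shuffle : ∀ n m → (n ℤ.- m) ℤ.+ m ≡ n
  shuffle = solve-∀
  eq : + ℤ.∣ n ℤ.- m ∣ ℤ.+ m ≡ n
  eq = trans (cong (ℤ._+ m) (ℤₚ.0≤i⇒+∣i∣≡i (ℤₚ.i≤j⇒0≤j-i m≤n))) (shuffle n m)

integer-cancel : ∀ {m n} → integer n ≥ᴳ integer m → m ℤ.≤ n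
integer-cancel {m} {n} n≥m with m ℤₚ.≤? n
... | yes m≤n = m≤n
... | no  m≰n = contradiction (suc-▷ n) (≥⇒⋫ (integer n) (integer (ℤ.suc n))
  (≥-trans (integer n) (integer m) (integer (ℤ.suc n)) n≥m (integer-mono (ℤₚ.i<j⇒suc[i]≤j (ℤₚ.≰⇒> m≰n)))))

≥-foldr-⊔ : ∀ {n} (f : Fin n → ℕ) i → f i ℕ.≤ foldr ℕ._⊔_ 0 f
≥-foldr-⊔ f zero = ℕₚ.m≤m⊔n (f zero) _
≥-foldr-⊔ f (suc i) = ℕₚ.≤-trans (≥-foldr-⊔ (f ∘ suc) i) (ℕₚ.m≤n⊔m (f zero) _)

birthday-left : ∀ G i → birthday (left G i) ℕ.< birthday G
birthday-left (game L R) i = ℕₚ.≤-trans (≥-foldr-⊔ (λ i → suc (birthday (L i))) i) (ℕₚ.m≤m⊔n _ _)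

birthday-right : ∀ G i → birthday (right G i) ℕ.< birthday G
birthday-right (game L R) i = ℕₚ.≤-trans (≥-foldr-⊔ (λ i → suc (birthday (R i))) i) (ℕₚ.m≤n⊔m _ _)

birthday-upper : ∀ G b → birthday G ℕ.≤ b → integer (+ b) ≥ᴳ G
birthday-upper G@(game L R) b le = ≥-intro (natural b) G (none b)
  λ i → leftOption i b (ℕₚ.<-≤-trans (birthday-left G i) le)
  where
  none : ∀ b j → right (natural b) j ▷ G
  none zero ()
  none (suc b) ()
  leftOption : ∀ i b → birthday (L i) ℕ.< b → natural b ▷ L i
  leftOption i (suc b) (ℕ.s≤s lt) = ▷-left (natural (suc b)) (L i) zero (birthday-upper (L i) b lt)

birthday-lower : ∀ G b → birthday G ℕ.≤ b → G ≥ᴳ ⊝ natural b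
birthday-lower G@(game L R) b le = ≥-intro G (⊝ natural b)
  (λ i → rightOption i b (ℕₚ.<-≤-trans (birthday-right G i) le)) (none b)
  where
  none : ∀ b i → G ▷ left (⊝ natural b) i
  none zero ()
  none (suc b) ()
  rightOption : ∀ i b → birthday (R i) ℕ.< b → R i ▷ ⊝ natural b
  rightOption i (suc b) (ℕ.s≤s lt) = ▷-right (R i) (⊝ natural (suc b)) zero (birthday-lower (R i) b lt)

integer-neg : ∀ b → integer (ℤ.- (+ b)) ≥ᴳ ⊝ natural b
integer-neg zero = ≥-intro (natural 0) (⊝ natural 0) (λ ()) (λ ())
integer-neg (suc b) = ≥-refl (⊝ natural (suc b))

neg-integer : ∀ b → ⊝ natural b ≥ᴳ integer (ℤ.- (+ b))
neg-integer zero = ≥-intro (⊝ natural 0) (natural 0) (λ ()) (λ ())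
neg-integer (suc b) = ≥-refl (⊝ natural (suc b))

_≥ᴳ?_ : ∀ G H → Dec (G ≥ᴳ H)
G ≥ᴳ? H = second? (G ⊖ H)

_≈ᴳ?_ : ∀ G H → Dec (G ≈ᴳ H)
G ≈ᴳ? H = (G ≥ᴳ? H) ×-dec (H ≥ᴳ? G)

isInteger? : ∀ G → Dec (IsInteger G)
isInteger? G with any? {suc (birthday G)} (λ k → (G ≈ᴳ? integer (+ toℕ k)) ⊎-dec (G ≈ᴳ? integer (ℤ.- (+ toℕ k))))
... | yes (k , inj₁ p) = yes (+ toℕ k , p)
... | yes (k , inj₂ p) = yes (ℤ.- (+ toℕ k) , p)
... | no ¬p = no λ (n , G≥n , n≥G) → ¬p (bounded n G≥n n≥G)
  where
  b = birthday G
  bounded : ∀ n → G ≥ᴳ integer n → integer n ≥ᴳ G →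
    ∃ λ (k : Fin (suc b)) → G ≈ᴳ integer (+ toℕ k) ⊎ G ≈ᴳ integer (ℤ.- (+ toℕ k))
  bounded (+ n) G≥n n≥G = fromℕ< {n} (ℕ.s≤s n≤b) ,
    inj₁ (subst (λ m → G ≈ᴳ natural m) (sym (toℕ-fromℕ< (ℕ.s≤s n≤b))) (G≥n , n≥G))
    where
    n≤b : n ℕ.≤ b
    n≤b = ℤₚ.drop‿+≤+ (integer-cancel (≥-trans (natural b) G (natural n) (birthday-upper G b ℕₚ.≤-refl) G≥n))
  bounded -[1+ n ] G≥n n≥G = fromℕ< {suc n} (ℕ.s≤s n≤b) ,
    inj₂ (subst (λ m → G ≈ᴳ integer (ℤ.- (+ m))) (sym (toℕ-fromℕ< (ℕ.s≤s n≤b))) (G≥n , n≥G))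
    where
    n≤b : suc n ℕ.≤ b
    n≤b = ℤₚ.drop‿+≤+ (ℤₚ.neg-cancel-≤ {+ b} {+ suc n} (integer-cancel {ℤ.- (+ b)} { -[1+ n ]} (≥-trans (integer -[1+ n ]) G (integer (ℤ.- (+ b))) n≥G
       (≥-trans G (⊝ natural b) (integer (ℤ.- (+ b))) (birthday-lower G b ℕₚ.≤-refl) (neg-integer b)))))

-- If an integer lies strictly between the Left and the Right options of G,
-- then G is equal to an integer.
simplicity⁺ : ∀ G n → (∀ i → left G i ⊲∣ natural n) → (∀ j → natural n ⊲∣ right G j) → IsInteger G
simplicity⁺ G@(game _ _) zero l r = + 0 ,
  ≥-intro G (natural 0) (λ j → ≱⇒▷ (natural 0) (right G j) (r j)) (λ ()) ,
  ≥-intro (natural 0) G (λ ()) (λ i → ≱⇒▷ (left G i) (natural 0) (l i))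
simplicity⁺ G@(game L R) (suc n) l r with any? (λ i → L i ≥ᴳ? natural n)
... | yes (i , p) = + suc n ,
  ≥-intro G (natural (suc n)) (λ j → ≱⇒▷ (natural (suc n)) (R j) (r j)) (λ _ → ▷-left G (natural n) i p) ,
  ≥-intro (natural (suc n)) G (λ ()) (λ i → ≱⇒▷ (L i) (natural (suc n)) (l i))
... | no ¬p = simplicity⁺ G n (λ i p → ¬p (i , p))
  (λ j p → r j (≥-trans (natural (suc n)) (natural n) (R j) (≥-suc (+ n)) p))

simplicity⁻ : ∀ G n → (∀ i → left G i ⊲∣ ⊝ natural n) → (∀ j → ⊝ natural n ⊲∣ right G j) → IsInteger G
simplicity⁻ G zero l r = simplicity⁺ G 0
  (λ i p → l i (≥-trans (left G i) (natural 0) (⊝ natural 0) p (integer-neg 0)))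
  (λ j p → r j (≥-trans (⊝ natural 0) (natural 0) (right G j) (neg-integer 0) p))
simplicity⁻ G@(game L R) (suc n) l r with any? (λ j → ⊝ natural n ≥ᴳ? R j)
... | yes (j , p) = -[1+ n ] ,
  ≥-intro G (⊝ natural (suc n)) (λ j → ≱⇒▷ (⊝ natural (suc n)) (R j) (r j)) (λ ()) ,
  ≥-intro (⊝ natural (suc n)) G (λ _ → ▷-right (⊝ natural n) G j p) (λ i → ≱⇒▷ (L i) (⊝ natural (suc n)) (l i))
... | no ¬p = simplicity⁻ G n
  (λ i p → l i (≥-trans (L i) (⊝ natural n) (⊝ natural (suc n)) p (⊝-mono n))) (λ j p → ¬p (j , p))
  where
  ⊝-mono : ∀ n → ⊝ natural n ≥ᴳ ⊝ natural (suc n)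
  ⊝-mono zero = ≥-intro (⊝ natural 0) (⊝ natural 1) (λ ()) (λ ())
  ⊝-mono (suc n) = ≥-suc -[1+ suc n ]

simplicity : ∀ G z → (∀ i → left G i ⊲∣ integer z) → (∀ j → integer z ⊲∣ right G j) → IsInteger G
simplicity G (+ n)    = simplicity⁺ G n
simplicity G -[1+ n ] = simplicity⁻ G (suc n)

ℚ-ring : AlmostCommutativeRing 0ℓ 0ℓ
ℚ-ring = fromCommutativeRing ℚₚ.+-*-commutativeRing (λ x → dec⇒maybe (0ℚ ℚₚ.≟ x))

≤-shift : ∀ {a b c d} → a ℚ.≤ b → c ℚ.- d ≡ a ℚ.- b → c ℚ.≤ d
≤-shift {a} {b} {c} {d} a≤b eq =
  subst₂ ℚ._≤_ (trans (cong (ℚ._+ d) (sym eq)) (lemma c d)) (cancel b d)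
    (ℚₚ.+-monoˡ-≤ d (ℚₚ.+-monoˡ-≤ (ℚ.- b) a≤b))
  where
  lemma : ∀ c d → c ℚ.- d ℚ.+ d ≡ c
  lemma = RingSolver.solve-∀ ℚ-ring
  cancel : ∀ b d → b ℚ.- b ℚ.+ d ≡ d
  cancel = RingSolver.solve-∀ ℚ-ring

<-shift : ∀ {a b c d} → a ℚ.< b → c ℚ.- d ≡ a ℚ.- b → c ℚ.< d
<-shift {a} {b} {c} {d} a<b eq =
  subst₂ ℚ._<_ (trans (cong (ℚ._+ d) (sym eq)) (lemma c d)) (cancel b d)
    (ℚₚ.+-monoˡ-< d (ℚₚ.+-monoˡ-< (ℚ.- b) a<b))
  where
  lemma : ∀ c d → c ℚ.- d ℚ.+ d ≡ c
  lemma = RingSolver.solve-∀ ℚ-ring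
  cancel : ∀ b d → b ℚ.- b ℚ.+ d ≡ d
  cancel = RingSolver.solve-∀ ℚ-ring

≤⇒≯ : ∀ {p q} → p ℚ.≤ q → ¬ q ℚ.< p
≤⇒≯ p≤q q<p = ℚₚ.<-irrefl refl (ℚₚ.≤-<-trans p≤q q<p)

1/2^-pos : ∀ n → 0ℚ ℚ.< value (1/2^ n)
1/2^-pos n = pos (2 ℕ.^ n) {{ℕₚ.m^n≢0 2 n}}
  where
  pos : ∀ d .{{_ : ℕ.NonZero d}} → 0ℚ ℚ.< unitFraction d
  pos (suc d) = ℚₚ.positive⁻¹ (unitFraction (suc d))

fromℤ-+ : ∀ i j → fromℤ (i ℤ.+ j) ≡ fromℤ i ℚ.+ fromℤ j
fromℤ-+ i j = sym (ℚₚ.toℚᵘ-injective (ℚᵘₚ.≃-trans (ℚₚ.toℚᵘ-homo-+ (fromℤ i) (fromℤ j))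
  (ℚᵘ.*≡* (ring i j))))
  where
  ring : ∀ i j → (i ℤ.* + 1 ℤ.+ j ℤ.* + 1) ℤ.* + 1 ≡ (i ℤ.+ j) ℤ.* + 1
  ring = solve-∀

fromInt-+ : ∀ i j → fromInt (i ℤ.+ j) ≡ fromInt i + fromInt j
fromInt-+ i j = ≡-value (fromInt (i ℤ.+ j)) (fromInt i + fromInt j) (fromℤ-+ i j)

fromInt-suc : ∀ z → fromInt (ℤ.suc z) ≡ fromInt z + 1/2^ 0
fromInt-suc z = ≡-value (fromInt (ℤ.suc z)) (fromInt z + 1/2^ 0)
  (trans (fromℤ-+ (+ 1) z) (ℚₚ.+-comm (fromℤ (+ 1)) (fromℤ z)))

fromInt-mono : ∀ {i j} → i ℤ.≤ j → fromInt i ≤ fromInt j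
fromInt-mono i≤j = ℚ.*≤* (ℤₚ.*-monoʳ-≤-nonNeg (+ 1) i≤j)

fromInt-cancel : ∀ {i j} → fromInt i ≤ fromInt j → i ℤ.≤ j
fromInt-cancel {i} {j} (ℚ.*≤* i≤j) = ℤₚ.*-cancelʳ-≤-pos i j (+ 1) i≤j

archimedean : ∀ x → ∃ λ k → x ≤ fromInt (+ k)
archimedean x = bound (value x)
  where
  bound : ∀ q → ∃ λ k → q ℚ.≤ fromℤ (+ k)
  bound (mkℚ (+ n) d c) = n , ℚ.*≤* (ℤₚ.*-monoˡ-≤-nonNeg (+ n) (ℤ.+≤+ (ℕ.s≤s (ℕ.z≤n {d}))))
  bound (mkℚ -[1+ n ] d c) = 0 , ℚ.*≤* ℤ.-≤+

-- The value on the empty family is never used: a game with no Left options, or no Right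
-- options, is equal to an integer (hasLeftOption, hasRightOption).
maximum minimum : ∀ {n} → (Fin n → ℤ[½]) → ℤ[½]
maximum {zero}        f = fromInt (+ 0)
maximum {suc zero}    f = f zero
maximum {suc (suc n)} f = f zero ⊔ maximum (λ i → f (suc i))
minimum {zero}        f = fromInt (+ 0)
minimum {suc zero}    f = f zero
minimum {suc (suc n)} f = f zero ⊓ minimum (λ i → f (suc i))

maximum-selects : ∀ {n} (f : Fin n → ℤ[½]) → Fin n → ∃ λ i → maximum f ≡ f i
maximum-selects {suc zero} f _ = zero , refl
maximum-selects {suc (suc n)} f _
  with f zero ≤? maximum (λ i → f (suc i)) | maximum-selects (λ i → f (suc i)) zero
... | yes _ | i , eq = suc i , eq
... | no  _ | _      = zero , refl

minimum-selects : ∀ {n} (f : Fin n → ℤ[½]) → Fin n → ∃ λ i → minimum f ≡ f i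
minimum-selects {suc zero} f _ = zero , refl
minimum-selects {suc (suc n)} f _
  with f zero ≤? minimum (λ i → f (suc i)) | minimum-selects (λ i → f (suc i)) zero
... | yes _ | _      = zero , refl
... | no  _ | i , eq = suc i , eq

≤-maximum : ∀ {n} (f : Fin n → ℤ[½]) i → f i ≤ maximum f
≤-maximum {suc zero} f zero = ℚₚ.≤-refl
≤-maximum {suc (suc n)} f i with f zero ≤? maximum (λ i → f (suc i)) | i
... | yes le | zero  = le
... | yes le | suc i = ≤-maximum (λ i → f (suc i)) i
... | no ¬le | zero  = ℚₚ.≤-refl
... | no ¬le | suc i = ℚₚ.≤-trans (≤-maximum (λ i → f (suc i)) i) (ℚₚ.<⇒≤ (ℚₚ.≰⇒> ¬le))

minimum-≤ : ∀ {n} (f : Fin n → ℤ[½]) i → minimum f ≤ f i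
minimum-≤ {suc zero} f zero = ℚₚ.≤-refl
minimum-≤ {suc (suc n)} f i with f zero ≤? minimum (λ i → f (suc i)) | i
... | yes le | zero  = ℚₚ.≤-refl
... | yes le | suc i = ℚₚ.≤-trans le (minimum-≤ (λ i → f (suc i)) i)
... | no ¬le | zero  = ℚₚ.<⇒≤ (ℚₚ.≰⇒> ¬le)
... | no ¬le | suc i = minimum-≤ (λ i → f (suc i)) i

-- Slopes between -1 and 0, and breakpoints in 2 ^ (- n) ℤ. Integrality of the values on that
-- grid forces linearity between neighbouring grid points.
record Falling (n : ℕ) (f : ℤ[½] → ℤ[½]) : Set where
  field
    monotone : ∀ s t → s ≤ t → f t ≤ f s
    slope    : ∀ s t → s ≤ t → f s + s ≤ f t + t
    grid     : ∀ t → exponent (f t) ℕ.≤ n ℕ.⊔ exponent t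

-- Slopes between 0 and 1.
record Rising (n : ℕ) (g : ℤ[½] → ℤ[½]) : Set where
  field
    monotone : ∀ s t → s ≤ t → g s ≤ g t
    slope    : ∀ s t → s ≤ t → g t - t ≤ g s - s
    grid     : ∀ t → exponent (g t) ℕ.≤ n ℕ.⊔ exponent t

IsLeast : (ℤ[½] → Set) → ℤ[½] → Set
IsLeast P t = P t × (∀ s → P s → t ≤ s)

grid-step : ∀ n x y → exponent x ℕ.≤ n → exponent y ℕ.≤ n → x ≤ y → y ≤ x + 1/2^ n →
  value y ≡ value x ⊎ value y ≡ value x ℚ.+ value (1/2^ n)
grid-step n x y ex ey x≤y y≤x+h with y ≤? x
... | yes y≤x = inj₁ (ℚₚ.≤-antisym y≤x x≤y)
... | no  y≰x = inj₂ (ℚₚ.≤-antisym y≤x+h (≤-shift gap (ring (value x) (value y) (value (1/2^ n)))))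
  where
  pos : ∀ x y → 0ℚ ℚ.- (y ℚ.- x) ≡ x ℚ.- y
  pos = RingSolver.solve-∀ ℚ-ring
  gap : 1/2^ n ≤ y - x
  gap = 1/2^-gap n (y - x) (ℕₚ.≤-trans (exponent-+ y (- x)) (ℕₚ.⊔-lub ey ex))
    (<-shift (ℚₚ.≰⇒> y≰x) (pos (value x) (value y)))
  ring : ∀ x y h → x ℚ.+ h ℚ.- y ≡ h ℚ.- (y ℚ.- x)
  ring = RingSolver.solve-∀ ℚ-ring

module Crossing {n f g} (falling : Falling n f) (rising : Rising n g) where
  private
    module F = Falling falling
    module G = Rising rising

  record Bracket (m : ℕ) : Set where
    constructor bracket
    field
      start    : ℤ[½]
      on-grid  : exponent start ℕ.≤ m
      above    : g start < f start
      below    : f (start + 1/2^ m) ≤ g (start + 1/2^ m)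

  search : ∀ k a → g (fromInt a) < f (fromInt a) →
    f (fromInt (+ k ℤ.+ a)) ≤ g (fromInt (+ k ℤ.+ a)) → Bracket 0
  search zero a above below = contradiction above
    (≤⇒≯ (subst (λ z → f (fromInt z) ≤ g (fromInt z)) (ℤₚ.+-identityˡ a) below))
  search (suc k) a above below = go (f s ≤? g s)
    where
    s : ℤ[½]
    s = fromInt (+ k ℤ.+ a)
    go : Dec (f s ≤ g s) → Bracket 0
    go (yes below′) = search k a above below′
    go (no ¬below′) = bracket s ℕ.z≤n (ℚₚ.≰⇒> ¬below′)
      (subst (λ t → f t ≤ g t) (trans (cong fromInt (ℤₚ.suc-+ k a)) (fromInt-suc (+ k ℤ.+ a))) below)

  halve : ∀ {m} → Bracket m → Bracket (suc m)
  halve {m} (bracket s on-grid above below) = go (f c ≤? g c)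
    where
    h c : ℤ[½]
    h = 1/2^ (suc m)
    c = s + h
    end : s + 1/2^ m ≡ c + h
    end = ≡-value (s + 1/2^ m) (c + h) (trans (cong (value s ℚ.+_) (sym (1/2^-half m)))
      (sym (ℚₚ.+-assoc (value s) (value h) (value h))))
    go : Dec (f c ≤ g c) → Bracket (suc m)
    go (yes below′) = bracket s (ℕₚ.m≤n⇒m≤1+n on-grid) above below′
    go (no ¬below′) = bracket c
      (ℕₚ.≤-trans (exponent-+ s h) (ℕₚ.⊔-lub (ℕₚ.m≤n⇒m≤1+n on-grid) ℕₚ.≤-refl))
      (ℚₚ.≰⇒> ¬below′) (subst (λ t → f t ≤ g t) end below)

  refine : ∀ m → Bracket 0 → Bracket m
  refine zero    b = b
  refine (suc m) b = halve (refine m b)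

  lowest : ∀ s → g s < f s → ∀ τ → f τ ≡ g τ → (∀ t → s < t → t < τ → g t < f t) →
    IsLeast (λ t → f t ≡ g t) τ
  lowest s gs<fs τ zeroτ before = zeroτ , least
    where
    least : ∀ t → f t ≡ g t → τ ≤ t
    least t ft≡gt with τ ≤? t
    ... | yes τ≤t = τ≤t
    ... | no  τ≰t with t ≤? s
    ...   | yes t≤s = contradiction (cong value (sym ft≡gt))
      (ℚₚ.<⇒≢ (ℚₚ.≤-<-trans (G.monotone t s t≤s) (ℚₚ.<-≤-trans gs<fs (F.monotone t s t≤s))))
    ...   | no  t≰s = contradiction (cong value (sym ft≡gt))
      (ℚₚ.<⇒≢ (before t (ℚₚ.≰⇒> t≰s) (ℚₚ.≰⇒> τ≰t)))

  least : Bracket n → ∃ (IsLeast (λ t → f t ≡ g t))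
  least (bracket s on-grid above below) = cases
    (grid-step n (f e) (f s) (onGrid f F.grid e e-grid) (onGrid f F.grid s on-grid) (F.monotone s e s≤e)
      (≤-shift (F.slope s e s≤e) (ringF (v f s) (v f e) S h)))
    (grid-step n (g s) (g e) (onGrid g G.grid s on-grid) (onGrid g G.grid e e-grid) (G.monotone s e s≤e)
      (≤-shift (G.slope s e s≤e) (ringG (v g s) (v g e) S h)))
    where
    v : (ℤ[½] → ℤ[½]) → ℤ[½] → ℚ
    v u t = value (u t)
    S h : ℚ
    S = value s
    h = value (1/2^ n)
    e : ℤ[½]
    e = s + 1/2^ n
    add-pos : ∀ s h → s ℚ.- (s ℚ.+ h) ≡ 0ℚ ℚ.- h
    add-pos = RingSolver.solve-∀ ℚ-ring
    s≤e : s ≤ e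
    s≤e = ≤-shift (ℚₚ.<⇒≤ (1/2^-pos n)) (add-pos S h)
    e-grid : exponent e ℕ.≤ n
    e-grid = ℕₚ.≤-trans (exponent-+ s (1/2^ n)) (ℕₚ.⊔-lub on-grid ℕₚ.≤-refl)
    onGrid : ∀ (u : ℤ[½] → ℤ[½]) → (∀ t → exponent (u t) ℕ.≤ n ℕ.⊔ exponent t) →
      ∀ t → exponent t ℕ.≤ n → exponent (u t) ℕ.≤ n
    onGrid u grid t t≤n = ℕₚ.≤-trans (grid t) (ℕₚ.⊔-lub ℕₚ.≤-refl t≤n)
    ringF : ∀ fs fe s h → fs ℚ.- (fe ℚ.+ h) ≡ fs ℚ.+ s ℚ.- (fe ℚ.+ (s ℚ.+ h))
    ringF = RingSolver.solve-∀ ℚ-ring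
    ringG : ∀ gs ge s h → ge ℚ.- (gs ℚ.+ h) ≡ ge ℚ.- (s ℚ.+ h) ℚ.- (gs ℚ.- s)
    ringG = RingSolver.solve-∀ ℚ-ring
    -- lower bound on f t and upper bound on g t for t beyond s
    f-bound : ∀ t → s < t → v f s ℚ.+ S ℚ.- value t ℚ.≤ v f t
    f-bound t s<t = ≤-shift (F.slope s t (ℚₚ.<⇒≤ s<t)) (ring (v f s) (v f t) S (value t))
      where
      ring : ∀ fs ft s t → fs ℚ.+ s ℚ.- t ℚ.- ft ≡ fs ℚ.+ s ℚ.- (ft ℚ.+ t)
      ring = RingSolver.solve-∀ ℚ-ring
    g-bound : ∀ t → s < t → v g t ℚ.≤ v g s ℚ.- S ℚ.+ value t
    g-bound t s<t = ≤-shift (G.slope s t (ℚₚ.<⇒≤ s<t)) (ring (v g s) (v g t) S (value t))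
      where
      ring : ∀ gs gt s t → gt ℚ.- (gs ℚ.- s ℚ.+ t) ≡ gt ℚ.- t ℚ.- (gs ℚ.- s)
      ring = RingSolver.solve-∀ ℚ-ring
    -- on the grid, strictly below means below by at least one step
    step-up : ∀ x y → exponent x ℕ.≤ n → exponent y ℕ.≤ n → x < y → value x ℚ.+ h ℚ.≤ value y
    step-up x y ex ey x<y = ≤-shift
      (1/2^-gap n (y - x) (ℕₚ.≤-trans (exponent-+ y (- x)) (ℕₚ.⊔-lub ey ex))
        (<-shift x<y (pos (value x) (value y))))
      (ring (value x) (value y) h)
      where
      pos : ∀ x y → 0ℚ ℚ.- (y ℚ.- x) ≡ x ℚ.- y
      pos = RingSolver.solve-∀ ℚ-ring
      ring : ∀ x y h → x ℚ.+ h ℚ.- y ≡ h ℚ.- (y ℚ.- x)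
      ring = RingSolver.solve-∀ ℚ-ring
    gs+h≤fs : v g s ℚ.+ h ℚ.≤ v f s
    gs+h≤fs = step-up (g s) (f s) (onGrid g G.grid s on-grid) (onGrid f F.grid s on-grid) above
    f-steep : ∀ t → s < t → t < e → v f s ≡ v f e ℚ.+ h → v f e ℚ.< v f t
    f-steep t s<t t<e fs≡ = ℚₚ.<-≤-trans (<-shift t<e (trans (cong (λ x → v f e ℚ.- (x ℚ.+ S ℚ.- value t)) fs≡)
        (ring (v f e) S (value t) h))) (f-bound t s<t)
      where
      ring : ∀ fe s t h → fe ℚ.- (fe ℚ.+ h ℚ.+ s ℚ.- t) ≡ t ℚ.- (s ℚ.+ h)
      ring = RingSolver.solve-∀ ℚ-ring
    g-steep : ∀ t → s < t → t < e → v g e ≡ v g s ℚ.+ h → v g t ℚ.< v g e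
    g-steep t s<t t<e ge≡ = ℚₚ.≤-<-trans (g-bound t s<t) (<-shift t<e
        (trans (cong (λ x → v g s ℚ.- S ℚ.+ value t ℚ.- x) ge≡) (ring (v g s) S (value t) h)))
      where
      ring : ∀ gs s t h → gs ℚ.- s ℚ.+ t ℚ.- (gs ℚ.+ h) ≡ t ℚ.- (s ℚ.+ h)
      ring = RingSolver.solve-∀ ℚ-ring
    cancel-h : ∀ a b h → a ℚ.- b ≡ a ℚ.+ h ℚ.- (b ℚ.+ h)
    cancel-h = RingSolver.solve-∀ ℚ-ring
    at-e-f : v f s ≡ v f e ℚ.+ h → v g e ℚ.≤ v f e → ∃ (IsLeast (λ t → f t ≡ g t))
    at-e-f fs≡ ge≤fe = e , lowest s above e (≡-value (f e) (g e) (ℚₚ.≤-antisym below ge≤fe))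
      λ t s<t t<e → ℚₚ.≤-<-trans (G.monotone t e (ℚₚ.<⇒≤ t<e)) (ℚₚ.≤-<-trans ge≤fe (f-steep t s<t t<e fs≡))
    at-e-g : v g e ≡ v g s ℚ.+ h → v g e ℚ.≤ v f e → ∃ (IsLeast (λ t → f t ≡ g t))
    at-e-g ge≡ ge≤fe = e , lowest s above e (≡-value (f e) (g e) (ℚₚ.≤-antisym below ge≤fe))
      λ t s<t t<e → ℚₚ.<-≤-trans (g-steep t s<t t<e ge≡) (ℚₚ.≤-trans ge≤fe (F.monotone t e (ℚₚ.<⇒≤ t<e)))
    half : ℚ
    half = value (1/2^ (suc n))
    m : ℤ[½]
    m = s + 1/2^ (suc n)
    s<m : s < m
    s<m = <-shift (1/2^-pos (suc n)) (add-pos S half)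
    m≤e : m ≤ e
    m≤e = ≤-shift (ℚₚ.<⇒≤ (1/2^-pos (suc n))) (trans (cong (λ x → S ℚ.+ half ℚ.- (S ℚ.+ x)) (sym (1/2^-half n))) (ring S half))
      where
      ring : ∀ s k → s ℚ.+ k ℚ.- (s ℚ.+ (k ℚ.+ k)) ≡ 0ℚ ℚ.- k
      ring = RingSolver.solve-∀ ℚ-ring
    middle : v f s ≡ v f e ℚ.+ h → v g e ≡ v g s ℚ.+ h → v f s ≡ v g s ℚ.+ h →
      ∃ (IsLeast (λ t → f t ≡ g t))
    middle fs≡ ge≡ fs≡′ = m , lowest s above m
      (≡-value (f m) (g m) (trans fm≡ (sym gm≡)))
      λ t s<t t<m → ℚₚ.≤-<-trans (g-bound t s<t) (ℚₚ.<-≤-trans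
        (<-shift (ℚₚ.+-mono-< t<m t<m) (trans (cong (λ x → v g s ℚ.- S ℚ.+ value t ℚ.- (x ℚ.+ S ℚ.- value t)) (trans fs≡′ (cong (v g s ℚ.+_) (sym (1/2^-half n))))) (ring₀ (v g s) S (value t) half)))
        (f-bound t s<t))
      where
      ring₀ : ∀ gs s t k → gs ℚ.- s ℚ.+ t ℚ.- (gs ℚ.+ (k ℚ.+ k) ℚ.+ s ℚ.- t) ≡ t ℚ.+ t ℚ.- (s ℚ.+ k ℚ.+ (s ℚ.+ k))
      ring₀ = RingSolver.solve-∀ ℚ-ring
      c : ℚ
      c = v g s ℚ.+ half
      fs≡c : v f s ≡ v g s ℚ.+ (half ℚ.+ half)
      fs≡c = trans fs≡′ (cong (v g s ℚ.+_) (sym (1/2^-half n)))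
      fe≡ : v f e ≡ v g s
      fe≡ = ℚₚ.≤-antisym
        (≤-shift (ℚₚ.≤-reflexive (trans (sym fs≡) fs≡′)) (cancel-h (v f e) (v g s) h))
        (≤-shift (ℚₚ.≤-reflexive (trans (sym fs≡′) fs≡)) (cancel-h (v g s) (v f e) h))
      ge≡c : v g e ≡ v g s ℚ.+ (half ℚ.+ half)
      ge≡c = trans ge≡ (cong (v g s ℚ.+_) (sym (1/2^-half n)))
      fm≡ : v f m ≡ c
      fm≡ = ℚₚ.≤-antisym
        (≤-shift (F.slope m e m≤e) (trans (ring₁ (v f m) (v g s) S half)
          (cong₂ (λ x y → v f m ℚ.+ (S ℚ.+ half) ℚ.- (x ℚ.+ (S ℚ.+ y))) (sym fe≡) (1/2^-half n))))
        (≤-shift (f-bound m s<m) (trans (ring₂ (v f m) (v g s) S half)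
          (cong (λ x → x ℚ.+ S ℚ.- (S ℚ.+ half) ℚ.- v f m) (sym fs≡c))))
        where
        ring₁ : ∀ fm gs s k → fm ℚ.- (gs ℚ.+ k) ≡ fm ℚ.+ (s ℚ.+ k) ℚ.- (gs ℚ.+ (s ℚ.+ (k ℚ.+ k)))
        ring₁ = RingSolver.solve-∀ ℚ-ring
        ring₂ : ∀ fm gs s k → gs ℚ.+ k ℚ.- fm ≡ gs ℚ.+ (k ℚ.+ k) ℚ.+ s ℚ.- (s ℚ.+ k) ℚ.- fm
        ring₂ = RingSolver.solve-∀ ℚ-ring
      gm≡ : v g m ≡ c
      gm≡ = ℚₚ.≤-antisym
        (≤-shift (g-bound m s<m) (ring₁ (v g m) (v g s) S half))
        (≤-shift (G.slope m e m≤e) (trans (ring₂ (v g m) (v g s) S half)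
          (cong₂ (λ x y → x ℚ.- (S ℚ.+ y) ℚ.- (v g m ℚ.- (S ℚ.+ half))) (sym ge≡c) (1/2^-half n))))
        where
        ring₁ : ∀ gm gs s k → gm ℚ.- (gs ℚ.+ k) ≡ gm ℚ.- (gs ℚ.- s ℚ.+ (s ℚ.+ k))
        ring₁ = RingSolver.solve-∀ ℚ-ring
        ring₂ : ∀ gm gs s k → gs ℚ.+ k ℚ.- gm ≡ gs ℚ.+ (k ℚ.+ k) ℚ.- (s ℚ.+ (k ℚ.+ k)) ℚ.- (gm ℚ.- (s ℚ.+ k))
        ring₂ = RingSolver.solve-∀ ℚ-ring
    cases : v f s ≡ v f e ⊎ v f s ≡ v f e ℚ.+ h → v g e ≡ v g s ⊎ v g e ≡ v g s ℚ.+ h →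
      ∃ (IsLeast (λ t → f t ≡ g t))
    cases (inj₁ fs≡) (inj₁ ge≡) = contradiction above (≤⇒≯ (subst₂ ℚ._≤_ (sym fs≡) ge≡ below))
    cases (inj₂ fs≡) (inj₁ ge≡) = at-e-f fs≡ (≤-shift gs+h≤fs
      (trans (cancel-h (v g e) (v f e) h) (cong₂ (λ x y → x ℚ.+ h ℚ.- y) ge≡ (sym fs≡))))
    cases (inj₁ fs≡) (inj₂ ge≡) = at-e-g ge≡ (subst₂ ℚ._≤_ (sym ge≡) fs≡ gs+h≤fs)
    cases (inj₂ fs≡) (inj₂ ge≡) with f s ≤? g s + 1/2^ n
    ... | yes fs≤ = middle fs≡ ge≡ (ℚₚ.≤-antisym fs≤ gs+h≤fs)
    ... | no  fs≰ = at-e-f fs≡ (≤-shift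
      (step-up (g s + 1/2^ n) (f s)
        (ℕₚ.≤-trans (exponent-+ (g s) (1/2^ n)) (ℕₚ.⊔-lub (onGrid g G.grid s on-grid) ℕₚ.≤-refl))
        (onGrid f F.grid s on-grid) (ℚₚ.≰⇒> fs≰))
      (trans (cancel-h (v g e) (v f e) h) (cong₂ (λ x y → x ℚ.+ h ℚ.- y) ge≡ (sym fs≡))))

  -- Opaque only to keep type checking fast: the term is large.
  opaque
    exists : ∀ k a → g (fromInt a) < f (fromInt a) →
      f (fromInt (+ k ℤ.+ a)) ≤ g (fromInt (+ k ℤ.+ a)) → ∃ (IsLeast (λ t → f t ≡ g t))
    exists k a above below = least (refine n (search k a above below))

-- canonical n k is the canonical form of n / 2 ^ k; for n = 2q + 1 and k > 0 the options are
-- q / 2 ^ (k - 1) and (q + 1) / 2 ^ (k - 1).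
canonical : ℤ → ℕ → Game
canonical n zero    = integer n
canonical n (suc k) with n ℤ.%ℕ 2
... | zero  = canonical (n ℤ./ℕ 2) k
... | suc _ = game {1} {1} (λ _ → canonical (n ℤ./ℕ 2) k) (λ _ → canonical (ℤ.suc (n ℤ./ℕ 2)) k)

⌜_⌝ : ℤ[½] → Game
⌜ x ⌝ = canonical (↥ value x) (exponent x)

-- f at and below τ, the constant x above.
upTo : ∀ {A : Set} → ℤ[½] → (ℤ[½] → A) → A → ℤ[½] → A
upTo τ f x t with t ≤? τ
... | yes _ = f t
... | no  _ = x

-- The first four fields are λ_t(G), ρ_t(G), G_t and t(G), with nothing for -∞. The others are
-- invariants from which the minimum defining t(G) is shown to exist. At t = -1 the scores are
-- the least integer ≥ G and the greatest integer ≤ G; by the simplicity theorem the maximum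
-- over Left options therefore exceeds the minimum over Right options at t = -1 unless G is
-- equal to an integer.
record Thermograph (G : Game) : Set where
  field
    leftScore   : ℤ[½] → ℤ[½]
    rightScore  : ℤ[½] → ℤ[½]
    cooled      : ℤ[½] → Game
    temperature : Maybe ℤ[½]
    order       : ℕ
    falling     : Falling order leftScore
    rising      : Rising order rightScore
    mast        : ℤ[½]
    right≤mast  : ∀ t → rightScore t ≤ mast
    mast≤left   : ∀ t → mast ≤ leftScore t
    ceiling     : ℤ
    floor       : ℤ
    left-1      : leftScore (fromInt -[1+ 0 ]) ≡ fromInt ceiling
    right-1     : rightScore (fromInt -[1+ 0 ]) ≡ fromInt floor
    ceiling-≥   : ∀ z → integer z ≥ᴳ G → ceiling ℤ.≤ z
    ceiling-≤   : ∀ z → ceiling ℤ.≤ z → integer z ≥ᴳ G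
    floor-≥     : ∀ z → G ≥ᴳ integer z → z ℤ.≤ floor
    floor-≤     : ∀ z → z ℤ.≤ floor → G ≥ᴳ integer z

upTo-≤ : ∀ {A : Set} τ (f : ℤ[½] → A) x t → t ≤ τ → upTo τ f x t ≡ f t
upTo-≤ τ f x t t≤τ with t ≤? τ
... | yes _   = refl
... | no  t≰τ = contradiction t≤τ t≰τ

upTo-> : ∀ {A : Set} τ (f : ℤ[½] → A) x t → τ < t → upTo τ f x t ≡ x
upTo-> τ f x t τ<t with t ≤? τ
... | yes t≤τ = contradiction τ<t (≤⇒≯ t≤τ)
... | no  _   = refl

upTo-falling : ∀ {n f} τ → Falling n f → Falling (n ℕ.⊔ exponent τ) (upTo τ f (f τ))
upTo-falling {n} {f} τ F = record { monotone = mono ; slope = slop ; grid = gri }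
  where
  open Falling F
  mono : ∀ s t → s ≤ t → upTo τ f (f τ) t ≤ upTo τ f (f τ) s
  mono s t s≤t with s ≤? τ | t ≤? τ
  ... | yes _ | yes _ = monotone s t s≤t
  ... | yes s≤τ | no _ = monotone s τ s≤τ
  ... | no s≰τ | yes t≤τ = contradiction (ℚₚ.≤-trans s≤t t≤τ) s≰τ
  ... | no _ | no _ = ℚₚ.≤-refl
  slop : ∀ s t → s ≤ t → upTo τ f (f τ) s + s ≤ upTo τ f (f τ) t + t
  slop s t s≤t with s ≤? τ | t ≤? τ
  ... | yes _ | yes _ = slope s t s≤t
  ... | yes s≤τ | no t≰τ = ℚₚ.≤-trans (slope s τ s≤τ) (ℚₚ.+-monoʳ-≤ (value (f τ)) (ℚₚ.<⇒≤ (ℚₚ.≰⇒> t≰τ)))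
  ... | no s≰τ | yes t≤τ = contradiction (ℚₚ.≤-trans s≤t t≤τ) s≰τ
  ... | no _ | no _ = ℚₚ.+-monoʳ-≤ (value (f τ)) s≤t
  gri : ∀ t → exponent (upTo τ f (f τ) t) ℕ.≤ n ℕ.⊔ exponent τ ℕ.⊔ exponent t
  gri t with t ≤? τ
  ... | yes _ = ℕₚ.≤-trans (grid t) (ℕₚ.⊔-monoˡ-≤ (exponent t) (ℕₚ.m≤m⊔n n (exponent τ)))
  ... | no  _ = ℕₚ.≤-trans (grid τ) (ℕₚ.m≤m⊔n (n ℕ.⊔ exponent τ) (exponent t))

upTo-rising : ∀ {n f} τ → Rising n f → Rising (n ℕ.⊔ exponent τ) (upTo τ f (f τ))
upTo-rising {n} {f} τ F = record { monotone = mono ; slope = slop ; grid = gri }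
  where
  open Rising F
  mono : ∀ s t → s ≤ t → upTo τ f (f τ) s ≤ upTo τ f (f τ) t
  mono s t s≤t with s ≤? τ | t ≤? τ
  ... | yes _ | yes _ = monotone s t s≤t
  ... | yes s≤τ | no _ = monotone s τ s≤τ
  ... | no s≰τ | yes t≤τ = contradiction (ℚₚ.≤-trans s≤t t≤τ) s≰τ
  ... | no _ | no _ = ℚₚ.≤-refl
  slop : ∀ s t → s ≤ t → upTo τ f (f τ) t - t ≤ upTo τ f (f τ) s - s
  slop s t s≤t with s ≤? τ | t ≤? τ
  ... | yes _ | yes _ = slope s t s≤t
  ... | yes s≤τ | no t≰τ = ℚₚ.≤-trans (ℚₚ.+-monoʳ-≤ (value (f τ)) (ℚₚ.neg-antimono-≤ (ℚₚ.<⇒≤ (ℚₚ.≰⇒> t≰τ)))) (slope s τ s≤τ)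
  ... | no s≰τ | yes t≤τ = contradiction (ℚₚ.≤-trans s≤t t≤τ) s≰τ
  ... | no _ | no _ = ℚₚ.+-monoʳ-≤ (value (f τ)) (ℚₚ.neg-antimono-≤ s≤t)
  gri : ∀ t → exponent (upTo τ f (f τ) t) ℕ.≤ n ℕ.⊔ exponent τ ℕ.⊔ exponent t
  gri t with t ≤? τ
  ... | yes _ = ℕₚ.≤-trans (grid t) (ℕₚ.⊔-monoˡ-≤ (exponent t) (ℕₚ.m≤m⊔n n (exponent τ)))
  ... | no  _ = ℕₚ.≤-trans (grid τ) (ℕₚ.m≤m⊔n (n ℕ.⊔ exponent τ) (exponent t))

upTo-≥-end : ∀ {n f} τ → Falling n f → ∀ t → f τ ≤ upTo τ f (f τ) t
upTo-≥-end τ F t with t ≤? τ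
... | yes t≤τ = Falling.monotone F t τ t≤τ
... | no  _   = ℚₚ.≤-refl

upTo-≤-end : ∀ {n f} τ → Rising n f → ∀ t → upTo τ f (f τ) t ≤ f τ
upTo-≤-end τ E t with t ≤? τ
... | yes t≤τ = Rising.monotone E t τ t≤τ
... | no  _   = ℚₚ.≤-refl

integerThermograph : ∀ G n → G ≈ᴳ integer n → Thermograph G
integerThermograph G n (G≥n , n≥G) = record
  { leftScore   = λ _ → fromInt n
  ; rightScore  = λ _ → fromInt n
  ; cooled      = λ _ → integer n
  ; temperature = nothing
  ; order       = 0
  ; falling     = record
    { monotone = λ _ _ _ → ℚₚ.≤-refl
    ; slope    = λ _ _ → ℚₚ.+-monoʳ-≤ (fromℤ n)
    ; grid     = λ _ → ℕ.z≤n
    }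
  ; rising      = record
    { monotone = λ _ _ _ → ℚₚ.≤-refl
    ; slope    = λ _ _ s≤t → ℚₚ.+-monoʳ-≤ (fromℤ n) (ℚₚ.neg-antimono-≤ s≤t)
    ; grid     = λ _ → ℕ.z≤n
    }
  ; mast        = fromInt n
  ; right≤mast  = λ _ → ℚₚ.≤-refl
  ; mast≤left   = λ _ → ℚₚ.≤-refl
  ; ceiling     = n
  ; floor       = n
  ; left-1      = refl
  ; right-1     = refl
  ; ceiling-≥   = λ z z≥G → integer-cancel (≥-trans (integer z) G (integer n) z≥G G≥n)
  ; ceiling-≤   = λ z n≤z → ≥-trans (integer z) (integer n) G (integer-mono n≤z) n≥G
  ; floor-≥     = λ z G≥z → integer-cancel (≥-trans (integer n) G (integer z) n≥G G≥z)
  ; floor-≤     = λ z z≤n → ≥-trans G (integer n) (integer z) G≥n (integer-mono z≤n)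
  }

birthday-below : ∀ G b → birthday G ℕ.≤ b → ⊝ natural (suc b) ⊲∣ G
birthday-below G b le p = ≥⇒⋫ (⊝ natural (suc b)) (⊝ natural b)
  (≥-trans (⊝ natural (suc b)) G (⊝ natural b) p (birthday-lower G b le))
  (▷-right (⊝ natural b) (⊝ natural (suc b)) zero (≥-refl (⊝ natural b)))

birthday-above : ∀ G b → birthday G ℕ.≤ b → G ⊲∣ natural (suc b)
birthday-above G b le p = ≥⇒⋫ (natural b) (natural (suc b))
  (≥-trans (natural b) G (natural (suc b)) (birthday-upper G b le) p)
  (▷-left (natural (suc b)) (natural b) zero (≥-refl (natural b)))

hasLeftOption : ∀ {m n} (L : Fin m → Game) (R : Fin n → Game) → ¬ IsInteger (game L R) → Fin m
hasLeftOption {suc m} L R _ = zero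
hasLeftOption {zero} L R ¬int = contradiction
  (simplicity⁻ G (suc (birthday G)) (λ ()) (λ j → birthday-below (R j) (birthday G) (ℕₚ.<⇒≤ (birthday-right G j)))) ¬int
  where G = game L R

hasRightOption : ∀ {m n} (L : Fin m → Game) (R : Fin n → Game) → ¬ IsInteger (game L R) → Fin n
hasRightOption {n = suc n} L R _ = zero
hasRightOption {n = zero} L R ¬int = contradiction
  (simplicity⁺ G (suc (birthday G)) (λ i → birthday-above (L i) (birthday G) (ℕₚ.<⇒≤ (birthday-left G i))) (λ ())) ¬int
  where G = game L R

≥-integer-right : ∀ G z j → G ≥ᴳ right (integer z) j → G ≥ᴳ integer (ℤ.suc z)
≥-integer-right G (+ zero) () _
≥-integer-right G (+ suc n) () _
≥-integer-right G -[1+ zero ] j p = ≥-trans G (⊝ natural 0) (natural 0) p (neg-integer 0)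
≥-integer-right G -[1+ suc n ] j p = p

≥-integer-left : ∀ G z i → left (integer z) i ≥ᴳ G → integer (ℤ.pred z) ≥ᴳ G
≥-integer-left G (+ zero) () _
≥-integer-left G (+ suc n) i p = p
≥-integer-left G -[1+ n ] () _

module Cooled {m n} (L : Fin m → Game) (R : Fin n → Game)
  (thermoL : ∀ i → Thermograph (L i)) (thermoR : ∀ j → Thermograph (R j)) where

  open Thermograph

  private
    G : Game
    G = game L R

  leftScore~ rightScore~ : ℤ[½] → ℤ[½]
  leftScore~  t = maximum (λ i → rightScore (thermoL i) t - t)
  rightScore~ t = minimum (λ j → leftScore (thermoR j) t + t)

  cooled~ : ℤ[½] → Game
  cooled~ t = game (λ i → cooled (thermoL i) t ⊖ ⌜ t ⌝) (λ j → cooled (thermoR j) t ⊕ ⌜ t ⌝)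

  orderL orderR order~ : ℕ
  orderL = foldr ℕ._⊔_ 0 (λ i → order (thermoL i))
  orderR = foldr ℕ._⊔_ 0 (λ j → order (thermoR j))
  order~ = orderL ℕ.⊔ orderR

  grid-bound : ∀ k x t → k ℕ.≤ order~ → exponent x ℕ.≤ k ℕ.⊔ exponent t → ∀ y → exponent y ℕ.≤ exponent t →
    exponent (x + y) ℕ.≤ order~ ℕ.⊔ exponent t
  grid-bound k x t k≤ x≤ y y≤ = ℕₚ.≤-trans (exponent-+ x y) (ℕₚ.⊔-lub
    (ℕₚ.≤-trans x≤ (ℕₚ.⊔-monoˡ-≤ (exponent t) k≤)) (ℕₚ.≤-trans y≤ (ℕₚ.m≤n⊔m order~ (exponent t))))

  falling~ : Fin m → Falling order~ leftScore~
  falling~ i₀ = record { monotone = mono ; slope = slop ; grid = gri }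
    where
    option : ∀ t → Fin m → ℤ[½]
    option t i = rightScore (thermoL i) t - t
    mono : ∀ s t → s ≤ t → leftScore~ t ≤ leftScore~ s
    mono s t s≤t with maximum-selects (option t) i₀
    ... | i , eq rewrite eq = ℚₚ.≤-trans (Rising.slope (rising (thermoL i)) s t s≤t) (≤-maximum (option s) i)
    ring : ∀ a b t → a ℚ.- t ℚ.+ t ℚ.- b ≡ a ℚ.- b
    ring = RingSolver.solve-∀ ℚ-ring
    ring′ : ∀ a b t → a ℚ.- (b ℚ.+ t) ≡ a ℚ.- t ℚ.- b
    ring′ = RingSolver.solve-∀ ℚ-ring
    slop : ∀ s t → s ≤ t → leftScore~ s + s ≤ leftScore~ t + t
    slop s t s≤t with maximum-selects (option s) i₀
    ... | i , eq rewrite eq = ℚₚ.≤-trans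
      (≤-shift (Rising.monotone (rising (thermoL i)) s t s≤t)
        (ring (value (rightScore (thermoL i) s)) (value (rightScore (thermoL i) t)) (value s)))
      (≤-shift (≤-maximum (option t) i)
        (ring′ (value (rightScore (thermoL i) t)) (value (leftScore~ t)) (value t)))
    gri : ∀ t → exponent (leftScore~ t) ℕ.≤ order~ ℕ.⊔ exponent t
    gri t with maximum-selects (option t) i₀
    ... | i , eq rewrite eq = grid-bound (order (thermoL i)) (rightScore (thermoL i) t) t
      (ℕₚ.≤-trans (≥-foldr-⊔ (λ i → order (thermoL i)) i) (ℕₚ.m≤m⊔n orderL orderR))
      (Rising.grid (rising (thermoL i)) t) (- t) ℕₚ.≤-refl

  rising~ : Fin n → Rising order~ rightScore~
  rising~ j₀ = record { monotone = mono ; slope = slop ; grid = gri }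
    where
    option : ∀ t → Fin n → ℤ[½]
    option t j = leftScore (thermoR j) t + t
    mono : ∀ s t → s ≤ t → rightScore~ s ≤ rightScore~ t
    mono s t s≤t with minimum-selects (option t) j₀
    ... | j , eq rewrite eq = ℚₚ.≤-trans (minimum-≤ (option s) j) (Falling.slope (falling (thermoR j)) s t s≤t)
    ring : ∀ a b t → b ℚ.- (a ℚ.+ t ℚ.- t) ≡ b ℚ.- a
    ring = RingSolver.solve-∀ ℚ-ring
    ring′ : ∀ a b t → b ℚ.- t ℚ.- a ≡ b ℚ.- (a ℚ.+ t)
    ring′ = RingSolver.solve-∀ ℚ-ring
    slop : ∀ s t → s ≤ t → rightScore~ t - t ≤ rightScore~ s - s
    slop s t s≤t with minimum-selects (option s) j₀
    ... | j , eq rewrite eq = ℚₚ.≤-trans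
      (≤-shift (minimum-≤ (option t) j)
        (ring′ (value (leftScore (thermoR j) t)) (value (rightScore~ t)) (value t)))
      (≤-shift (Falling.monotone (falling (thermoR j)) s t s≤t)
        (ring (value (leftScore (thermoR j) s)) (value (leftScore (thermoR j) t)) (value s)))
    gri : ∀ t → exponent (rightScore~ t) ℕ.≤ order~ ℕ.⊔ exponent t
    gri t with minimum-selects (option t) j₀
    ... | j , eq rewrite eq = grid-bound (order (thermoR j)) (leftScore (thermoR j) t) t
      (ℕₚ.≤-trans (≥-foldr-⊔ (λ j → order (thermoR j)) j) (ℕₚ.m≤n⊔m orderL orderR))
      (Falling.grid (falling (thermoR j)) t) t ℕₚ.≤-refl

  module NonInteger (¬int : ¬ IsInteger G) where

    i₀ : Fin m
    i₀ = hasLeftOption L R ¬int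

    j₀ : Fin n
    j₀ = hasRightOption L R ¬int

    F : Falling order~ leftScore~
    F = falling~ i₀

    E : Rising order~ rightScore~
    E = rising~ j₀

    -1𝔻 : ℤ[½]
    -1𝔻 = fromInt -[1+ 0 ]

    left-1~ : ∃ λ z → leftScore~ -1𝔻 ≡ fromInt z × (∃ λ i → z ≡ ℤ.suc (floor (thermoL i)))
      × (∀ i → ℤ.suc (floor (thermoL i)) ℤ.≤ z)
    left-1~ with maximum-selects (λ i → rightScore (thermoL i) -1𝔻 - -1𝔻) i₀
    ... | i , eq = z , eqz , (i , refl) , λ i′ → fromInt-cancel (subst₂ _≤_ (value-at i′) eqz
        (≤-maximum (λ i → rightScore (thermoL i) -1𝔻 - -1𝔻) i′))
      where
      z = ℤ.suc (floor (thermoL i))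
      value-at : ∀ i → rightScore (thermoL i) -1𝔻 - -1𝔻 ≡ fromInt (ℤ.suc (floor (thermoL i)))
      value-at i = trans (cong (_- -1𝔻) (right-1 (thermoL i)))
        (trans (≡-value (fromInt (floor (thermoL i)) - -1𝔻) (fromInt (floor (thermoL i)) + fromInt (+ 1)) refl)
        (trans (sym (fromInt-+ (floor (thermoL i)) (+ 1))) (cong fromInt (ℤₚ.+-comm (floor (thermoL i)) (+ 1)))))
      eqz : leftScore~ -1𝔻 ≡ fromInt z
      eqz = trans eq (value-at i)

    right-1~ : ∃ λ z → rightScore~ -1𝔻 ≡ fromInt z × (∃ λ j → z ≡ ℤ.pred (ceiling (thermoR j)))
      × (∀ j → z ℤ.≤ ℤ.pred (ceiling (thermoR j)))
    right-1~ with minimum-selects (λ j → leftScore (thermoR j) -1𝔻 + -1𝔻) j₀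
    ... | j , eq = z , eqz , (j , refl) , λ j′ → fromInt-cancel (subst₂ _≤_ eqz (value-at j′)
        (minimum-≤ (λ j → leftScore (thermoR j) -1𝔻 + -1𝔻) j′))
      where
      z = ℤ.pred (ceiling (thermoR j))
      value-at : ∀ j → leftScore (thermoR j) -1𝔻 + -1𝔻 ≡ fromInt (ℤ.pred (ceiling (thermoR j)))
      value-at j = trans (cong (_+ -1𝔻) (left-1 (thermoR j)))
        (trans (sym (fromInt-+ (ceiling (thermoR j)) -[1+ 0 ])) (cong fromInt (ℤₚ.+-comm (ceiling (thermoR j)) -[1+ 0 ])))
      eqz : rightScore~ -1𝔻 ≡ fromInt z
      eqz = trans eq (value-at j)

    ceiling~ floor~ : ℤ
    ceiling~ = proj₁ left-1~
    floor~   = proj₁ right-1~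

    -- a Left option is ≱ z exactly when z > its floor, and dually
    left-⊲∣ : ∀ z i → floor (thermoL i) ℤ.< z → L i ⊲∣ integer z
    left-⊲∣ z i lt p = ℤₚ.<-irrefl refl (ℤₚ.<-≤-trans lt (floor-≥ (thermoL i) z p))

    ⊲∣-right : ∀ z j → z ℤ.< ceiling (thermoR j) → integer z ⊲∣ R j
    ⊲∣-right z j lt p = ℤₚ.<-irrefl refl (ℤₚ.<-≤-trans lt (ceiling-≥ (thermoR j) z p))

    no-gap : ∀ z → ceiling~ ℤ.≤ z → ¬ z ℤ.≤ floor~
    no-gap z c≤z z≤f = ¬int (simplicity G z
      (λ i → left-⊲∣ z i (ℤₚ.suc[i]≤j⇒i<j (ℤₚ.≤-trans (proj₂ (proj₂ (proj₂ left-1~)) i) c≤z)))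
      (λ j → ⊲∣-right z j (ℤₚ.i≤pred[j]⇒i<j (ℤₚ.≤-trans z≤f (proj₂ (proj₂ (proj₂ right-1~)) j)))))

    above : rightScore~ -1𝔻 < leftScore~ -1𝔻
    above = ℚₚ.≰⇒> λ le → no-gap ceiling~ ℤₚ.≤-refl
      (fromInt-cancel (subst₂ _≤_ (proj₁ (proj₂ left-1~)) (proj₁ (proj₂ right-1~)) le))

    ceiling-≥~ : ∀ z → integer z ≥ᴳ G → ceiling~ ℤ.≤ z
    ceiling-≥~ z z≥G with proj₁ (proj₂ (proj₂ left-1~))
    ... | i , eq = subst (ℤ._≤ z) (sym eq) (ℤₚ.i<j⇒suc[i]≤j (ℤₚ.≰⇒> λ z≤ →
      ≥⇒⋫ (L i) (integer z) (floor-≤ (thermoL i) z z≤) (≥-right′ z z≥G i)))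
      where
      ≥-right′ : ∀ z → integer z ≥ᴳ G → ∀ i → integer z ▷ L i
      ≥-right′ z = ≥-left (integer z) G

    floor-≥~ : ∀ z → G ≥ᴳ integer z → z ℤ.≤ floor~
    floor-≥~ z G≥z with proj₁ (proj₂ (proj₂ right-1~))
    ... | j , eq = subst (z ℤ.≤_) (sym eq) (ℤₚ.i<j⇒i≤pred[j] (ℤₚ.≰⇒> λ ≤z →
      ≥⇒⋫ (integer z) (R j) (ceiling-≤ (thermoR j) z ≤z) (≥-right G (integer z) G≥z j)))

    ceiling-≤~ : ∀ z → ceiling~ ℤ.≤ z → integer z ≥ᴳ G
    ceiling-≤~ z c≤z = ⋫⇒≥ (integer z) G λ G▷z → [ byLeft , byRight ] (▷-elim G (integer z) G▷z)
      where
      byLeft : (∃ λ i → L i ≥ᴳ integer z) → ⊥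
      byLeft (i , p) = left-⊲∣ z i (ℤₚ.suc[i]≤j⇒i<j (ℤₚ.≤-trans (proj₂ (proj₂ (proj₂ left-1~)) i) c≤z)) p
      byRight : (∃ λ j → G ≥ᴳ right (integer z) j) → ⊥
      byRight (j , p) = no-gap (ℤ.suc z) (ℤₚ.≤-trans c≤z (ℤₚ.i≤suc[i] z)) (floor-≥~ (ℤ.suc z) (≥-integer-right G z j p))

    floor-≤~ : ∀ z → z ℤ.≤ floor~ → G ≥ᴳ integer z
    floor-≤~ z z≤f = ⋫⇒≥ G (integer z) λ z▷G → [ byLeft , byRight ] (▷-elim (integer z) G z▷G)
      where
      byLeft : (∃ λ i → left (integer z) i ≥ᴳ G) → ⊥
      byLeft (i , p) = no-gap (ℤ.pred z) (ceiling-≥~ (ℤ.pred z) (≥-integer-left G z i p)) (ℤₚ.≤-trans (ℤₚ.i≤j⇒pred[i]≤j ℤₚ.≤-refl) z≤f)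
      byRight : (∃ λ j → integer z ≥ᴳ R j) → ⊥
      byRight (j , p) = ⊲∣-right z j (ℤₚ.i≤pred[j]⇒i<j (ℤₚ.≤-trans z≤f (proj₂ (proj₂ (proj₂ right-1~)) j))) p

    -- the walls have met by the time t exceeds the spread of the masts
    M N : ℤ[½]
    M = maximum (λ i → mast (thermoL i))
    N = minimum (λ j → mast (thermoR j))

    late : ℕ
    late = proj₁ (archimedean (M - N))

    below : leftScore~ (fromInt (+ late)) ≤ rightScore~ (fromInt (+ late))
    below with maximum-selects (λ i → rightScore (thermoL i) T - T) i₀ | minimum-selects (λ j → leftScore (thermoR j) T + T) j₀
      where T = fromInt (+ late)
    ... | i , eqL | j , eqR rewrite eqL | eqR = ℚₚ.≤-trans left≤ (ℚₚ.≤-trans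
      (≤-shift (ℚₚ.+-mono-≤ (proj₂ (archimedean (M - N))) (fromInt-mono {+ 0} {+ late} (ℤ.+≤+ ℕ.z≤n))) (ring (value M) (value N) t))
      right≥)
      where
      t : ℚ
      t = fromℤ (+ late)
      T : ℤ[½]
      T = fromInt (+ late)
      left≤ : rightScore (thermoL i) T - T ≤ M - T
      left≤ = ℚₚ.+-monoˡ-≤ (ℚ.- t) (ℚₚ.≤-trans (right≤mast (thermoL i) T) (≤-maximum (λ i → mast (thermoL i)) i))
      right≥ : N + T ≤ leftScore (thermoR j) T + T
      right≥ = ℚₚ.+-monoˡ-≤ t (ℚₚ.≤-trans (minimum-≤ (λ j → mast (thermoR j)) j) (mast≤left (thermoR j) T))
      ring : ∀ M N t → M ℚ.- t ℚ.- (N ℚ.+ t) ≡ M ℚ.- N ℚ.+ 0ℚ ℚ.- (t ℚ.+ t)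
      ring = RingSolver.solve-∀ ℚ-ring

    meeting : ∃ (IsLeast (λ t → leftScore~ t ≡ rightScore~ t))
    meeting = Crossing.exists F E (suc late) -[1+ 0 ] above below

    τ x : ℤ[½]
    τ = proj₁ meeting
    x = leftScore~ τ

    meet : leftScore~ τ ≡ rightScore~ τ
    meet = proj₁ (proj₂ meeting)

    -1≤τ : -1𝔻 ≤ τ
    -1≤τ = ℚₚ.≮⇒≥ λ τ<-1 → ℚₚ.<⇒≢ (ℚₚ.≤-<-trans (Rising.monotone E τ -1𝔻 (ℚₚ.<⇒≤ τ<-1))
      (ℚₚ.<-≤-trans above (Falling.monotone F τ -1𝔻 (ℚₚ.<⇒≤ τ<-1)))) (cong value (sym meet))

    thermographOfNonInteger : Thermograph G
    thermographOfNonInteger = record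
      { leftScore   = upTo τ leftScore~ x
      ; rightScore  = upTo τ rightScore~ x
      ; cooled      = upTo τ cooled~ ⌜ x ⌝
      ; temperature = just τ
      ; order       = order~ ℕ.⊔ exponent τ
      ; falling     = upTo-falling τ F
      ; rising      = subst (λ y → Rising (order~ ℕ.⊔ exponent τ) (upTo τ rightScore~ y)) (sym meet) (upTo-rising τ E)
      ; mast        = x
      ; right≤mast  = λ t → subst (λ y → upTo τ rightScore~ y t ≤ y) (sym meet) (upTo-≤-end τ E t)
      ; mast≤left   = upTo-≥-end τ F
      ; ceiling     = ceiling~
      ; floor       = floor~
      ; left-1      = trans (upTo-≤ τ leftScore~ x -1𝔻 -1≤τ) (proj₁ (proj₂ left-1~))
      ; right-1     = trans (upTo-≤ τ rightScore~ x -1𝔻 -1≤τ) (proj₁ (proj₂ right-1~))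
      ; ceiling-≥   = ceiling-≥~
      ; ceiling-≤   = ceiling-≤~
      ; floor-≥     = floor-≥~
      ; floor-≤     = floor-≤~
      }

  thermographByCases : Dec (IsInteger G) → Thermograph G
  thermographByCases (yes (n , G≈n)) = integerThermograph G n G≈n
  thermographByCases (no ¬int)       = NonInteger.thermographOfNonInteger ¬int

thermograph : ∀ G → Thermograph G
thermograph (game L R) = Cooled.thermographByCases L R (λ i → thermograph (L i)) (λ j → thermograph (R j))
  (isInteger? (game L R))


-- lam G t = λ_t(G), rho G t = ρ_t(G), cool G t = G_t, temp G = t(G); lam~, rho~ and cool~ are
-- the versions with a tilde, meaningful when G is not equal to an integer.
lam rho : Game → ℤ[½] → ℤ[½]
lam G = Thermograph.leftScore  (thermograph G)
rho G = Thermograph.rightScore (thermograph G)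

cool : Game → ℤ[½] → Game
cool G = Thermograph.cooled (thermograph G)

temp : Game → Maybe ℤ[½]
temp G = Thermograph.temperature (thermograph G)

lam~ rho~ : Game → ℤ[½] → ℤ[½]
lam~ (game L R) t = maximum (λ i → rho (L i) t - t)
rho~ (game L R) t = minimum (λ j → lam (R j) t + t)

cool~ : Game → ℤ[½] → Game
cool~ (game L R) t = game (λ i → cool (L i) t ⊖ ⌜ t ⌝) (λ j → cool (R j) t ⊕ ⌜ t ⌝)

-- The defining recursion: integer-clause and noninteger-clause together determine lam, rho,
-- cool and temp.
integer-clause : ∀ G n → G ≈ᴳ integer n →
  temp G ≡ nothing ×
  (∀ t → lam G t ≡ fromInt n × rho G t ≡ fromInt n × cool G t ≡ ⌜ fromInt n ⌝)
integer-clause (game L R) n (G≥n , n≥G) = go (isInteger? (game L R))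
  where
  G = game L R
  open Cooled L R (λ i → thermograph (L i)) (λ j → thermograph (R j))
  open Thermograph
  go : (d : Dec (IsInteger G)) → let T = thermographByCases d in temperature T ≡ nothing ×
    (∀ t → leftScore T t ≡ fromInt n × rightScore T t ≡ fromInt n × cooled T t ≡ ⌜ fromInt n ⌝)
  go (no ¬int) = contradiction (n , G≥n , n≥G) ¬int
  go (yes (m , G≥m , m≥G)) with ℤₚ.≤-antisym {m} {n}
    (integer-cancel {m} {n} (≥-trans (integer n) G (integer m) n≥G G≥m))
    (integer-cancel {n} {m} (≥-trans (integer m) G (integer n) m≥G G≥n))
  ... | refl = refl , λ t → refl , refl , refl

noninteger-clause : ∀ G → ¬ IsInteger G → ∃ λ τ →
  temp G ≡ just τ ×
  IsLeast (λ t → lam~ G t ≡ rho~ G t) τ ×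
  (∀ t → t ≤ τ → lam G t ≡ lam~ G t × rho G t ≡ rho~ G t × cool G t ≡ cool~ G t) ×
  (∀ t → τ < t → lam G t ≡ lam~ G τ × rho G t ≡ lam~ G τ × cool G t ≡ ⌜ lam~ G τ ⌝)
noninteger-clause (game L R) ¬int = go (isInteger? (game L R))
  where
  G = game L R
  open Cooled L R (λ i → thermograph (L i)) (λ j → thermograph (R j))
  open Thermograph
  go : (d : Dec (IsInteger G)) → let T = thermographByCases d in ∃ λ τ →
    temperature T ≡ just τ ×
    IsLeast (λ t → leftScore~ t ≡ rightScore~ t) τ ×
    (∀ t → t ≤ τ → leftScore T t ≡ leftScore~ t × rightScore T t ≡ rightScore~ t × cooled T t ≡ cooled~ t) ×
    (∀ t → τ < t → leftScore T t ≡ leftScore~ τ × rightScore T t ≡ leftScore~ τ × cooled T t ≡ ⌜ leftScore~ τ ⌝)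
  go (yes int) = contradiction int ¬int
  go (no ¬p) = τ , refl , proj₂ meeting ,
    (λ t t≤τ → upTo-≤ τ leftScore~ x t t≤τ , upTo-≤ τ rightScore~ x t t≤τ , upTo-≤ τ cooled~ ⌜ x ⌝ t t≤τ) ,
    (λ t τ<t → upTo-> τ leftScore~ x t τ<t , upTo-> τ rightScore~ x t τ<t , upTo-> τ cooled~ ⌜ x ⌝ t τ<t)
    where open NonInteger ¬p

InInterval : ℤ[½] → ℤ[½] → ℤ[½] → Set
InInterval a b t = a < t × t ≤ b

ConstantOn StrictlyDecreasingOn StrictlyIncreasingOn : (ℤ[½] → Set) → (ℤ[½] → ℤ[½]) → Set
ConstantOn           I f = ∀ s t → I s → I t → f s ≡ f t
StrictlyDecreasingOn I f = ∀ s t → I s → I t → s < t → f t < f s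
StrictlyIncreasingOn I f = ∀ s t → I s → I t → s < t → f s < f t

{-# OPTIONS --safe #-}
module Submission where

-- Write ρ for a Right score ρ_t(K), a function of t with slopes 0 and 1. Number comparisons with
-- K_t only see the scores, except at the number ρ itself, where the slope of ρ just before t
-- decides: K_t ≥ ρ when the slope is 0, and not when it is 1. For s < t this is proved by
-- induction on K in terms of the two endpoint conditions ρ_t ≤ ρ_s and ρ_s - s ≤ ρ_t - t, which,
-- unlike statements about the slope at t, pass to the options attaining the maximum or minimum;
-- the induction alternates between ρ and the Left score λ. Strict monotonicity is turned into an
-- endpoint condition on a grid of dyadic rationals fine enough to force slope ±1.

open import Algebra.Bundles using (AbelianGroup)
import Algebra.Properties.Group as GroupProperties
open import Data.Fin.Base using (zero)
open import Data.Integer.Base as ℤ using (ℤ; +_; -[1+_])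
import Data.Integer.DivMod as ℤᵈ
import Data.Integer.Properties as ℤₚ
open import Data.Integer.Tactic.RingSolver using (solve-∀)
open import Data.Nat.Base as ℕ using (ℕ; zero; suc)
import Data.Nat.Properties as ℕₚ
open import Data.Product using (_×_; ∃; _,_; proj₁; proj₂; uncurry)
open import Data.Rational.Base as ℚ using (ℚ; 0ℚ; ↥_; mkℚ)
open import Data.Rational.Literals using (fromℤ)
import Data.Rational.Properties as ℚₚ
import Data.Rational.Unnormalised.Base as ℚᵘ
import Data.Rational.Unnormalised.Properties as ℚᵘₚ
open import Data.Sum.Base using ([_,_])
open import Relation.Binary.PropositionalEquality hiding ([_])
open import Relation.Nullary.Decidable using (Dec; yes; no)
open import Relation.Nullary.Negation using (¬_; contradiction)
import Tactic.RingSolver as RingSolver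
open import Defs
open GroupProperties (AbelianGroup.group ℤₚ.+-0-abelianGroup) using () renaming (∙-cancelˡ to +-cancelˡ)
open ℤ[½]

-- Order and addition of games

⊕-lefts : ∀ {p} (P : Game → Set p) G H →
  (∀ i → P (left G i ⊕ H)) → (∀ i → P (G ⊕ left H i)) → ∀ k → P (left (G ⊕ H) k)
⊕-lefts P G@(game L R) H@(game L′ R′) = ++-∀ {P = P} (λ i → L i ⊕ H) (λ i → G ⊕ L′ i)

⊕-rights : ∀ {p} (P : Game → Set p) G H →
  (∀ j → P (right G j ⊕ H)) → (∀ j → P (G ⊕ right H j)) → ∀ k → P (right (G ⊕ H) k)
⊕-rights P G@(game L R) H@(game L′ R′) = ++-∀ {P = P} (λ j → R j ⊕ H) (λ j → G ⊕ R′ j)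

⊕-▷ˡ : ∀ G H K i → left G i ⊕ H ≥ᴳ K → G ⊕ H ▷ K
⊕-▷ˡ G@(game L R) H@(game L′ R′) K i p =
  let k , q = ++-∃ˡ {P = _≥ᴳ K} (λ i → L i ⊕ H) (λ i → G ⊕ L′ i) i p in ▷-left (G ⊕ H) K k q

⊕-▷ʳ : ∀ G H K i → G ⊕ left H i ≥ᴳ K → G ⊕ H ▷ K
⊕-▷ʳ G@(game L R) H@(game L′ R′) K i p =
  let k , q = ++-∃ʳ {P = _≥ᴳ K} (λ i → L i ⊕ H) (λ i → G ⊕ L′ i) i p in ▷-left (G ⊕ H) K k q

▷-⊕ˡ : ∀ K G H j → K ≥ᴳ right G j ⊕ H → K ▷ G ⊕ H
▷-⊕ˡ K G@(game L R) H@(game L′ R′) j p =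
  let k , q = ++-∃ˡ {P = K ≥ᴳ_} (λ j → R j ⊕ H) (λ j → G ⊕ R′ j) j p in ▷-right K (G ⊕ H) k q

▷-⊕ʳ : ∀ K G H j → K ≥ᴳ G ⊕ right H j → K ▷ G ⊕ H
▷-⊕ʳ K G@(game L R) H@(game L′ R′) j p =
  let k , q = ++-∃ʳ {P = K ≥ᴳ_} (λ j → R j ⊕ H) (λ j → G ⊕ R′ j) j p in ▷-right K (G ⊕ H) k q

≥-▷-trans : ∀ G H K → G ≥ᴳ H → H ▷ K → G ▷ K
≥-▷-trans G H K G≥H H▷K = ≱⇒▷ K G λ K≥G → ≥⇒⋫ K H (≥-trans K G H K≥G G≥H) H▷K

▷-≥-trans : ∀ G H K → G ▷ H → H ≥ᴳ K → G ▷ K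
▷-≥-trans G H K G▷H H≥K = ≱⇒▷ K G λ K≥G → ≥⇒⋫ H G (≥-trans H K G H≥K K≥G) G▷H

mutual
  -- A move in `K` is answered by the same move in the other copy of `K`, and a move in `G` or `H`
  -- by the reply that `G ≥ᴳ H` supplies; such replies are `▷` statements, whence the mutual
  -- recursion.
  ⊕-monoˡ : ∀ G H K → G ≥ᴳ H → G ⊕ K ≥ᴳ H ⊕ K
  ⊕-monoˡ G@(game L R) H@(game L′ R′) K@(game L″ R″) G≥H = ≥-intro (G ⊕ K) (H ⊕ K)
    (⊕-rights (_▷ H ⊕ K) G K
      (λ j → ⊕-mono-▷ˡ (R j) H K (≥-right G H G≥H j))
      (λ j → ▷-⊕ʳ (G ⊕ R″ j) H K j (⊕-monoˡ G H (R″ j) G≥H)))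
    (⊕-lefts (G ⊕ K ▷_) H K
      (λ i → ⊕-mono-▷ˡ G (L′ i) K (≥-left G H G≥H i))
      (λ i → ⊕-▷ʳ G K (H ⊕ L″ i) i (⊕-monoˡ G H (L″ i) G≥H)))

  ⊕-mono-▷ˡ : ∀ G H K → G ▷ H → G ⊕ K ▷ H ⊕ K
  ⊕-mono-▷ˡ G@(game L R) H@(game L′ R′) K G▷H =
    [ (λ (i , p) → ⊕-▷ˡ G K (H ⊕ K) i (⊕-monoˡ (L i) H K p))
    , (λ (j , p) → ▷-⊕ˡ (G ⊕ K) H K j (⊕-monoˡ G (R′ j) K p)) ] (▷-elim G H G▷H)

-- `▷` is the negation of the reversed `≥ᴳ`, so this is the contrapositive of strict monotonicity.
⊕-cancelʳ : ∀ G H K → G ⊕ K ≥ᴳ H ⊕ K → G ≥ᴳ H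
⊕-cancelʳ G H K p = ⋫⇒≥ G H λ H▷G → ≥⇒⋫ (G ⊕ K) (H ⊕ K) p (⊕-mono-▷ˡ H G K H▷G)

⊕-comm : ∀ G H → G ⊕ H ≥ᴳ H ⊕ G
⊕-comm G@(game L R) H@(game L′ R′) = ≥-intro (G ⊕ H) (H ⊕ G)
  (⊕-rights (_▷ H ⊕ G) G H
    (λ j → ▷-⊕ʳ (R j ⊕ H) H G j (⊕-comm (R j) H))
    (λ j → ▷-⊕ˡ (G ⊕ R′ j) H G j (⊕-comm G (R′ j))))
  (⊕-lefts (G ⊕ H ▷_) H G
    (λ i → ⊕-▷ʳ G H (L′ i ⊕ G) i (⊕-comm G (L′ i)))
    (λ i → ⊕-▷ˡ G H (H ⊕ L i) i (⊕-comm (L i) H)))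

⊕-monoʳ : ∀ K G H → G ≥ᴳ H → K ⊕ G ≥ᴳ K ⊕ H
⊕-monoʳ K G H p = ≥-trans (K ⊕ G) (G ⊕ K) (K ⊕ H) (⊕-comm K G)
  (≥-trans (G ⊕ K) (H ⊕ K) (K ⊕ H) (⊕-monoˡ G H K p) (⊕-comm H K))

⊕-mono : ∀ G G′ H H′ → G ≥ᴳ G′ → H ≥ᴳ H′ → G ⊕ H ≥ᴳ G′ ⊕ H′
⊕-mono G G′ H H′ p q = ≥-trans (G ⊕ H) (G′ ⊕ H) (G′ ⊕ H′) (⊕-monoˡ G G′ H p) (⊕-monoʳ G′ H H′ q)

⊖-⊕-▷ˡ : ∀ G T H K i → left G i ⊖ T ⊕ H ≥ᴳ K → G ⊖ T ⊕ H ▷ K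
⊖-⊕-▷ˡ G@(game L R) T@(game L′ R′) H K i p =
  let k , q = ++-∃ˡ {P = λ X → X ⊕ H ≥ᴳ K} (λ i → L i ⊖ T) (λ j → G ⊖ R′ j) i p in ⊕-▷ˡ (G ⊖ T) H K k q

⊖-⊕-▷ʳ : ∀ G T H K j → G ⊖ right T j ⊕ H ≥ᴳ K → G ⊖ T ⊕ H ▷ K
⊖-⊕-▷ʳ G@(game L R) T@(game L′ R′) H K j p =
  let k , q = ++-∃ʳ {P = λ X → X ⊕ H ≥ᴳ K} (λ i → L i ⊖ T) (λ j → G ⊖ R′ j) j p in ⊕-▷ˡ (G ⊖ T) H K k q

▷-⊖-⊕ˡ : ∀ K G T H j → K ≥ᴳ right G j ⊖ T ⊕ H → K ▷ G ⊖ T ⊕ H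
▷-⊖-⊕ˡ K G@(game L R) T@(game L′ R′) H j p =
  let k , q = ++-∃ˡ {P = λ X → K ≥ᴳ X ⊕ H} (λ j → R j ⊖ T) (λ i → G ⊖ L′ i) j p in ▷-⊕ˡ K (G ⊖ T) H k q

▷-⊖-⊕ʳ : ∀ K G T H i → K ≥ᴳ G ⊖ left T i ⊕ H → K ▷ G ⊖ T ⊕ H
▷-⊖-⊕ʳ K G@(game L R) T@(game L′ R′) H i p =
  let k , q = ++-∃ʳ {P = λ X → K ≥ᴳ X ⊕ H} (λ j → R j ⊖ T) (λ i → G ⊖ L′ i) i p in ▷-⊕ˡ K (G ⊖ T) H k q

-- Left mirrors moves between `T` and `⊝ T`, and between the two copies of `G`. Together with
-- `≥-⊖-⊕` this lets a summand change sides without an appeal to associativity of `⊕`.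
⊖-⊕-≥ : ∀ G T → G ⊖ T ⊕ T ≥ᴳ G
⊖-⊕-≥ G@(game L R) T@(game L′ R′) = ≥-intro (G ⊖ T ⊕ T) G
  (⊕-rights (_▷ G) (G ⊖ T) T
    (⊕-rights (λ X → X ⊕ T ▷ G) G (⊝ T)
      (λ j → ▷-right (R j ⊖ T ⊕ T) G j (⊖-⊕-≥ (R j) T))
      (λ i → ⊕-▷ʳ (G ⊖ L′ i) T G i (⊖-⊕-≥ G (L′ i))))
    (λ j → ⊖-⊕-▷ʳ G T (R′ j) G j (⊖-⊕-≥ G (R′ j))))
  (λ i → ⊖-⊕-▷ˡ G T T (L i) i (⊖-⊕-≥ (L i) T))

≥-⊖-⊕ : ∀ G T → G ≥ᴳ G ⊖ T ⊕ T
≥-⊖-⊕ G@(game L R) T@(game L′ R′) = ≥-intro G (G ⊖ T ⊕ T)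
  (λ j → ▷-⊖-⊕ˡ (R j) G T T j (≥-⊖-⊕ (R j) T))
  (⊕-lefts (G ▷_) (G ⊖ T) T
    (⊕-lefts (λ X → G ▷ X ⊕ T) G (⊝ T)
      (λ i → ▷-left G (L i ⊖ T ⊕ T) i (≥-⊖-⊕ (L i) T))
      (λ j → ▷-⊕ʳ G (G ⊖ R′ j) T j (≥-⊖-⊕ G (R′ j))))
    (λ i → ▷-⊖-⊕ʳ G G T (L′ i) i (≥-⊖-⊕ G (L′ i))))

⊖-≥⇒≥-⊕ : ∀ G T H → G ⊖ T ≥ᴳ H → G ≥ᴳ H ⊕ T
⊖-≥⇒≥-⊕ G T H p = ≥-trans G (G ⊖ T ⊕ T) (H ⊕ T) (≥-⊖-⊕ G T) (⊕-monoˡ (G ⊖ T) H T p)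

≥-⊕⇒⊖-≥ : ∀ G T H → G ≥ᴳ H ⊕ T → G ⊖ T ≥ᴳ H
≥-⊕⇒⊖-≥ G T H p = ⊕-cancelʳ (G ⊖ T) H T (≥-trans (G ⊖ T ⊕ T) G (H ⊕ T) (⊖-⊕-≥ G T) p)

-- Canonical forms of dyadic rationals

-- The games n / 2ᵏ, for fixed k.
record Scale (c : ℤ → Game) : Set where
  field
    increasing : ∀ n → c (ℤ.suc n) ≥ᴳ c n
    strict     : ∀ n → c (ℤ.suc n) ▷ c n
    lefts      : ∀ n i → c n ≥ᴳ left (c (ℤ.suc n)) i
    rights     : ∀ n j → right (c n) j ≥ᴳ c (ℤ.suc n)
    superadditive : ∀ m n → c m ⊕ c n ≥ᴳ c (m ℤ.+ n)
    negative   : ∀ n → ⊝ c n ≥ᴳ c (ℤ.- n)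

  -- The reverse inequality comes from the field `superadditive` at `m + n` and `- n`, after `c n`
  -- is moved to the other side.
  subadditive : ∀ m n → c (m ℤ.+ n) ≥ᴳ c m ⊕ c n
  subadditive m n = ⊖-≥⇒≥-⊕ (c (m ℤ.+ n)) (c n) (c m)
    (≥-trans (c (m ℤ.+ n) ⊖ c n) (c (m ℤ.+ n) ⊕ c (ℤ.- n)) (c m)
      (⊕-monoʳ (c (m ℤ.+ n)) (⊝ c n) (c (ℤ.- n)) (negative n))
      (subst (λ k → c (m ℤ.+ n) ⊕ c (ℤ.- n) ≥ᴳ c k) (shuffle m n) (superadditive (m ℤ.+ n) (ℤ.- n))))
    where
    shuffle : ∀ m n → m ℤ.+ n ℤ.+ ℤ.- n ≡ m
    shuffle = solve-∀

  ≥-left-option : ∀ n i → c n ≥ᴳ left (c n) i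
  ≥-left-option n i = ≥-trans (c n) (c (ℤ.pred n)) (left (c n) i)
    (subst (λ k → c k ≥ᴳ c (ℤ.pred n)) (ℤₚ.suc-pred n) (increasing (ℤ.pred n)))
    (below n (ℤₚ.suc-pred n) i)
    where
    -- The type of `i` depends on `n`, so the equation is matched with `n` general instead of
    -- transporting `i`.
    below : ∀ n {m} → ℤ.suc m ≡ n → ∀ i → c m ≥ᴳ left (c n) i
    below _ {m} refl i = lefts m i

  right-option-≥ : ∀ n j → right (c n) j ≥ᴳ c n
  right-option-≥ n j = ≥-trans (right (c n) j) (c (ℤ.suc n)) (c n) (rights n j) (increasing n)

  mono-+ : ∀ k n → c (+ k ℤ.+ n) ≥ᴳ c n
  mono-+ zero n = subst (λ m → c m ≥ᴳ c n) (sym (ℤₚ.+-identityˡ n)) (≥-refl (c n))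
  mono-+ (suc k) n = ≥-trans (c (+ suc k ℤ.+ n)) (c (+ k ℤ.+ n)) (c n)
    (subst (λ m → c m ≥ᴳ c (+ k ℤ.+ n)) (sym (ℤₚ.suc-+ k n)) (increasing (+ k ℤ.+ n))) (mono-+ k n)

  mono : ∀ {m n} → m ℤ.≤ n → c n ≥ᴳ c m
  mono {m} {n} m≤n = subst (λ k → c k ≥ᴳ c m)
    (trans (cong (ℤ._+ m) (ℤₚ.0≤i⇒+∣i∣≡i (ℤₚ.i≤j⇒0≤j-i m≤n))) (shuffle n m)) (mono-+ ℤ.∣ n ℤ.- m ∣ m)
    where
    shuffle : ∀ n m → (n ℤ.- m) ℤ.+ m ≡ n
    shuffle = solve-∀

  strict-mono : ∀ {m n} → m ℤ.< n → c n ▷ c m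
  strict-mono {m} {n} m<n = ≥-▷-trans (c n) (c (ℤ.suc m)) (c m) (mono (ℤₚ.i<j⇒suc[i]≤j m<n)) (strict m)

between : Game → Game → Game
between G H = game {1} {1} (λ _ → G) (λ _ → H)

data Parity : ℤ → Set where
  even : ∀ q → Parity (q ℤ.* + 2)
  odd  : ∀ q → Parity (+ 1 ℤ.+ q ℤ.* + 2)

parity : ∀ n → Parity n
parity n with n ℤ.%ℕ 2 | n ℤ./ℕ 2 | ℤᵈ.a≡a%ℕn+[a/ℕn]*n n 2 | ℤᵈ.n%ℕd<d n 2
... | 0 | q | eq | _ = subst Parity (sym (trans eq (ℤₚ.+-identityˡ _))) (even q)
... | 1 | q | eq | _ = subst Parity (sym eq) (odd q)
... | suc (suc _) | _ | _ | ℕ.s≤s (ℕ.s≤s ())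

-- Passage from denominator 2ᵏ to 2ᵏ⁺¹: even multiples are the old games, odd ones sit between two
-- old neighbours. Only these two equations about `c′` enter, so the division inside `canonical`
-- stays out of the argument.
module Halving {c c′ : ℤ → Game} (scale : Scale c)
  (even-≡ : ∀ q → c′ (q ℤ.* + 2) ≡ c q)
  (odd-≡ : ∀ q → c′ (+ 1 ℤ.+ q ℤ.* + 2) ≡ between (c q) (c (ℤ.suc q))) where

  open Scale scale

  mid : ℤ → Game
  mid q = between (c q) (c (ℤ.suc q))

  mid-≥ : ∀ q → mid q ≥ᴳ c q
  mid-≥ q = ≥-intro (mid q) (c q) (λ _ → strict q)
    (λ i → ▷-left (mid q) (left (c q) i) zero (≥-left-option q i))

  ≥-mid : ∀ q → c (ℤ.suc q) ≥ᴳ mid q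
  ≥-mid q = ≥-intro (c (ℤ.suc q)) (mid q)
    (λ j → ▷-right (right (c (ℤ.suc q)) j) (mid q) zero (right-option-≥ (ℤ.suc q) j)) (λ _ → strict q)

  mid-▷ : ∀ q → mid q ▷ c q
  mid-▷ q = ▷-left (mid q) (c q) zero (≥-refl (c q))

  ▷-mid : ∀ q → c (ℤ.suc q) ▷ mid q
  ▷-mid q = ▷-right (c (ℤ.suc q)) (mid q) zero (≥-refl (c (ℤ.suc q)))

  suc-odd : ∀ q → c′ (ℤ.suc (+ 1 ℤ.+ q ℤ.* + 2)) ≡ c (ℤ.suc q)
  suc-odd q = trans (cong c′ (shuffle q)) (even-≡ (ℤ.suc q))
    where
    shuffle : ∀ q → + 1 ℤ.+ (+ 1 ℤ.+ q ℤ.* + 2) ≡ (+ 1 ℤ.+ q) ℤ.* + 2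
    shuffle = solve-∀

  -- When Right moves in `c r` the game rises by at least a whole old step, by `rights`, so the half
  -- step in `mid q` can be given away.
  mid-c-≥ : ∀ q r → mid q ⊕ c r ≥ᴳ mid (q ℤ.+ r)
  mid-c-≥ q r = ≥-intro (mid q ⊕ c r) (mid (q ℤ.+ r))
    (⊕-rights (_▷ mid (q ℤ.+ r)) (mid q) (c r)
      (λ _ → ▷-right (c (ℤ.suc q) ⊕ c r) (mid (q ℤ.+ r)) zero
        (subst (λ k → c (ℤ.suc q) ⊕ c r ≥ᴳ c k) (ℤₚ.+-assoc (+ 1) q r) (superadditive (ℤ.suc q) r)))
      (λ j → ▷-right (mid q ⊕ right (c r) j) (mid (q ℤ.+ r)) zero
        (≥-trans (mid q ⊕ right (c r) j) (c q ⊕ c (ℤ.suc r)) (c (ℤ.suc (q ℤ.+ r)))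
          (⊕-mono (mid q) (c q) (right (c r) j) (c (ℤ.suc r)) (mid-≥ q) (rights r j))
          (subst (λ k → c q ⊕ c (ℤ.suc r) ≥ᴳ c k) (shuffle q r) (superadditive q (ℤ.suc r))))))
    (λ _ → ⊕-▷ˡ (mid q) (c r) (c (q ℤ.+ r)) zero (superadditive q r))
    where
    shuffle : ∀ q r → q ℤ.+ (+ 1 ℤ.+ r) ≡ + 1 ℤ.+ (q ℤ.+ r)
    shuffle = solve-∀

  -- Whichever midpoint Right raises, Left lowers the other, and the total is exact. Against a Left
  -- option of `c s`, which is at most `c (q + r)`, Left lowers one midpoint and gives away the half
  -- step of the other.
  mid-mid-≥ : ∀ q r → mid q ⊕ mid r ≥ᴳ c (ℤ.suc (q ℤ.+ r))
  mid-mid-≥ q r = ≥-intro (mid q ⊕ mid r) (c s)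
    (⊕-rights (_▷ c s) (mid q) (mid r)
      (λ _ → ⊕-▷ʳ (c (ℤ.suc q)) (mid r) (c s) zero
        (subst (λ k → c (ℤ.suc q) ⊕ c r ≥ᴳ c k) (ℤₚ.+-assoc (+ 1) q r) (superadditive (ℤ.suc q) r)))
      (λ _ → ⊕-▷ˡ (mid q) (c (ℤ.suc r)) (c s) zero
        (subst (λ k → c q ⊕ c (ℤ.suc r) ≥ᴳ c k) (shuffle q r) (superadditive q (ℤ.suc r)))))
    (λ i → ⊕-▷ˡ (mid q) (mid r) (left (c s) i) zero
      (≥-trans (c q ⊕ mid r) (c q ⊕ c r) (left (c s) i) (⊕-monoʳ (c q) (mid r) (c r) (mid-≥ r))
        (≥-trans (c q ⊕ c r) (c (q ℤ.+ r)) (left (c s) i) (superadditive q r) (lefts (q ℤ.+ r) i))))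
    where
    s : ℤ
    s = ℤ.suc (q ℤ.+ r)
    shuffle : ∀ q r → q ℤ.+ (+ 1 ℤ.+ r) ≡ + 1 ℤ.+ (q ℤ.+ r)
    shuffle = solve-∀

  odd-+-even : ∀ q r → + 1 ℤ.+ q ℤ.* + 2 ℤ.+ r ℤ.* + 2 ≡ + 1 ℤ.+ (q ℤ.+ r) ℤ.* + 2
  odd-+-even = solve-∀

  even-+-odd : ∀ q r → q ℤ.* + 2 ℤ.+ (+ 1 ℤ.+ r ℤ.* + 2) ≡ + 1 ℤ.+ (r ℤ.+ q) ℤ.* + 2
  even-+-odd = solve-∀

  odd-+-odd : ∀ q r → + 1 ℤ.+ q ℤ.* + 2 ℤ.+ (+ 1 ℤ.+ r ℤ.* + 2) ≡ (+ 1 ℤ.+ (q ℤ.+ r)) ℤ.* + 2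
  odd-+-odd = solve-∀

  neg-odd : ∀ q → ℤ.- (+ 1 ℤ.+ q ℤ.* + 2) ≡ + 1 ℤ.+ ℤ.- (+ 1 ℤ.+ q) ℤ.* + 2
  neg-odd = solve-∀

  superadditive′ : ∀ m n → Parity m → Parity n → c′ m ⊕ c′ n ≥ᴳ c′ (m ℤ.+ n)
  superadditive′ _ _ (even q) (even r)
    rewrite sym (ℤₚ.*-distribʳ-+ (+ 2) q r) | even-≡ q | even-≡ r | even-≡ (q ℤ.+ r) = superadditive q r
  superadditive′ _ _ (odd q) (even r)
    rewrite odd-+-even q r | odd-≡ q | even-≡ r | odd-≡ (q ℤ.+ r) = mid-c-≥ q r
  superadditive′ _ _ (even q) (odd r)
    rewrite even-+-odd q r | odd-≡ r | even-≡ q | odd-≡ (r ℤ.+ q) =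
    ≥-trans (c q ⊕ mid r) (mid r ⊕ c q) (mid (r ℤ.+ q)) (⊕-comm (c q) (mid r)) (mid-c-≥ r q)
  superadditive′ _ _ (odd q) (odd r)
    rewrite odd-+-odd q r | odd-≡ q | odd-≡ r | even-≡ (+ 1 ℤ.+ (q ℤ.+ r)) = mid-mid-≥ q r

  increasing′ : ∀ n → Parity n → c′ (ℤ.suc n) ≥ᴳ c′ n
  increasing′ _ (even q) rewrite odd-≡ q | even-≡ q = mid-≥ q
  increasing′ _ (odd q) rewrite suc-odd q | odd-≡ q = ≥-mid q

  strict′ : ∀ n → Parity n → c′ (ℤ.suc n) ▷ c′ n
  strict′ _ (even q) rewrite odd-≡ q | even-≡ q = mid-▷ q
  strict′ _ (odd q) rewrite suc-odd q | odd-≡ q = ▷-mid q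

  lefts′ : ∀ n → Parity n → ∀ i → c′ n ≥ᴳ left (c′ (ℤ.suc n)) i
  lefts′ _ (even q) rewrite odd-≡ q | even-≡ q = λ _ → ≥-refl (c q)
  lefts′ _ (odd q) rewrite suc-odd q | odd-≡ q = λ i →
    ≥-trans (mid q) (c q) (left (c (ℤ.suc q)) i) (mid-≥ q) (lefts q i)

  rights′ : ∀ n → Parity n → ∀ j → right (c′ n) j ≥ᴳ c′ (ℤ.suc n)
  rights′ _ (even q) rewrite odd-≡ q | even-≡ q = λ j →
    ≥-trans (right (c q) j) (c (ℤ.suc q)) (mid q) (rights q j) (≥-mid q)
  rights′ _ (odd q) rewrite suc-odd q | odd-≡ q = λ _ → ≥-refl (c (ℤ.suc q))

  negative′ : ∀ n → Parity n → ⊝ c′ n ≥ᴳ c′ (ℤ.- n)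
  negative′ _ (even q) rewrite ℤₚ.neg-distribˡ-* q (+ 2) | even-≡ q | even-≡ (ℤ.- q) = negative q
  -- The negative of the midpoint of q and q + 1 is the midpoint of -(q + 1) and -q; `r` is its
  -- lower end.
  negative′ _ (odd q) rewrite neg-odd q | odd-≡ q | odd-≡ (ℤ.- (+ 1 ℤ.+ q)) = ≥-intro (⊝ mid q) (mid r)
    (λ _ → ▷-right (⊝ c q) (mid r) zero (subst (λ k → ⊝ c q ≥ᴳ c k) (shuffle q) (negative q)))
    (λ _ → ▷-left (⊝ mid q) (c r) zero (negative (ℤ.suc q)))
    where
    r : ℤ
    r = ℤ.- ℤ.suc q
    shuffle : ∀ q → ℤ.- q ≡ + 1 ℤ.+ ℤ.- (+ 1 ℤ.+ q)
    shuffle = solve-∀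

  halved : Scale c′
  halved = record
    { increasing    = λ n → increasing′ n (parity n)
    ; strict        = λ n → strict′ n (parity n)
    ; lefts         = λ n → lefts′ n (parity n)
    ; rights        = λ n → rights′ n (parity n)
    ; superadditive = λ m n → superadditive′ m n (parity m) (parity n)
    ; negative      = λ n → negative′ n (parity n)
    }

-- Integers as the coarsest scale

integer-lefts : ∀ z i → integer z ≥ᴳ left (integer (ℤ.suc z)) i
integer-lefts (+ n) zero = ≥-refl (natural n)
integer-lefts -[1+ zero ] ()
integer-lefts -[1+ suc n ] ()

integer-rights : ∀ z j → right (integer z) j ≥ᴳ integer (ℤ.suc z)
integer-rights (+ zero) ()
integer-rights (+ suc n) ()
integer-rights -[1+ zero ] zero = neg-integer 0
integer-rights -[1+ suc n ] zero = ≥-refl (⊝ natural (suc n))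

integer-negative : ∀ z → ⊝ integer z ≥ᴳ integer (ℤ.- z)
integer-negative (+ zero) = neg-integer 0
integer-negative (+ suc n) = ≥-refl (⊝ natural (suc n))
integer-negative -[1+ n ] = ⊝⊝ (suc n)
  where
  ⊝⊝ : ∀ n → ⊝ ⊝ natural n ≥ᴳ natural n
  ⊝⊝ zero = ≥-intro (⊝ ⊝ natural 0) (natural 0) (λ ()) (λ ())
  ⊝⊝ (suc n) = ≥-intro (⊝ ⊝ natural (suc n)) (natural (suc n)) (λ ())
    (λ _ → ▷-left (⊝ ⊝ natural (suc n)) (natural n) zero (⊝⊝ n))

natural-no-right : ∀ n → ¬ RightOption (natural n)
natural-no-right zero ()
natural-no-right (suc n) ()

mutual
  -- Stated for arbitrary games above two integers, so that the induction runs through the options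
  -- of `G` and `H` while `m` and `n`, whose signs may differ, are free to change.
  ⊕-≥-integer : ∀ G H m n → G ≥ᴳ integer m → H ≥ᴳ integer n → G ⊕ H ≥ᴳ integer (m ℤ.+ n)
  ⊕-≥-integer G@(game L R) H@(game L′ R′) m n p q = ≥-intro (G ⊕ H) (integer (m ℤ.+ n))
    (⊕-rights (_▷ integer (m ℤ.+ n)) G H
      (λ j → ⊕-▷-integer (R j) H m n (≥-right G (integer m) p j) q)
      (λ j → ≥-▷-trans (G ⊕ R′ j) (R′ j ⊕ G) (integer (m ℤ.+ n)) (⊕-comm G (R′ j))
        (subst (λ z → R′ j ⊕ G ▷ integer z) (ℤₚ.+-comm n m)
          (⊕-▷-integer (R′ j) G n m (≥-right H (integer n) q j) p))))
    (⊕-▷-left-integer G H m n p q)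

  ⊕-▷-integer : ∀ G H m n → G ▷ integer m → H ≥ᴳ integer n → G ⊕ H ▷ integer (m ℤ.+ n)
  ⊕-▷-integer G@(game L R) H m n p q =
    [ (λ (i , r) → ⊕-▷ˡ G H (integer (m ℤ.+ n)) i (⊕-≥-integer (L i) H m n r q))
    -- A Right option of the integer m is m + 1 in value, so here `G` has a whole unit to spare.
    , (λ (j , r) → ≥-▷-trans (G ⊕ H) (integer (ℤ.suc (m ℤ.+ n))) (integer (m ℤ.+ n))
        (subst (λ z → G ⊕ H ≥ᴳ integer z) (ℤₚ.+-assoc (+ 1) m n)
          (⊕-≥-integer G H (ℤ.suc m) n (≥-integer-right G m j r) q))
        (suc-▷ (m ℤ.+ n))) ] (▷-elim G (integer m) p)

  -- A Left option of `integer (m + n)` requires m + n > 0, hence m or n positive. If m = a + 1 then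
  -- `G ▷ natural a`, and since `natural a` has no Right option, some Left option of `G` is at least
  -- a; Left moves there.
  ⊕-▷-left-integer : ∀ G H m n → G ≥ᴳ integer m → H ≥ᴳ integer n → ∀ i → G ⊕ H ▷ left (integer (m ℤ.+ n)) i
  ⊕-▷-left-integer G@(game L R) H (+ suc a) n p q =
    [ (λ (i , r) → subst (λ z → ∀ k → G ⊕ H ▷ left (integer z) k) (sym (ℤₚ.suc-+ a n))
        λ k → ▷-≥-trans (G ⊕ H) (integer (+ a ℤ.+ n)) (left (integer (ℤ.suc (+ a ℤ.+ n))) k)
          (⊕-▷ˡ G H (integer (+ a ℤ.+ n)) i (⊕-≥-integer (L i) H (+ a) n r q)) (integer-lefts (+ a ℤ.+ n) k))
    , (λ (j , _) → contradiction j (natural-no-right a)) ] (▷-elim G (natural a) (≥-left G (natural (suc a)) p zero))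
  ⊕-▷-left-integer G H@(game L R) m (+ suc b) p q =
    [ (λ (i , r) → subst (λ z → ∀ k → G ⊕ H ▷ left (integer z) k) (sym (shuffle m (+ b)))
        λ k → ▷-≥-trans (G ⊕ H) (integer (m ℤ.+ + b)) (left (integer (ℤ.suc (m ℤ.+ + b))) k)
          (⊕-▷ʳ G H (integer (m ℤ.+ + b)) i (⊕-≥-integer G (L i) m (+ b) p r)) (integer-lefts (m ℤ.+ + b) k))
    , (λ (j , _) → contradiction j (natural-no-right b)) ] (▷-elim H (natural b) (≥-left H (natural (suc b)) q zero))
    where
    shuffle : ∀ m b → m ℤ.+ (+ 1 ℤ.+ b) ≡ + 1 ℤ.+ (m ℤ.+ b)
    shuffle = solve-∀
  ⊕-▷-left-integer _ _ (+ zero) (+ zero) _ _ ()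
  ⊕-▷-left-integer _ _ (+ zero) -[1+ b ] _ _ ()
  ⊕-▷-left-integer _ _ -[1+ a ] (+ zero) _ _ ()
  ⊕-▷-left-integer _ _ -[1+ a ] -[1+ b ] _ _ ()

integer-scale : Scale integer
integer-scale = record
  { increasing    = ≥-suc
  ; strict        = suc-▷
  ; lefts         = integer-lefts
  ; rights        = integer-rights
  ; superadditive = λ m n → ⊕-≥-integer (integer m) (integer n) m n (≥-refl (integer m)) (≥-refl (integer n))
  ; negative      = integer-negative
  }

-- Division by two and the recursion of `canonical`

0+2q≢1+2r : ∀ q r → ¬ + 0 ℤ.+ q ℤ.* + 2 ≡ + 1 ℤ.+ r ℤ.* + 2
0+2q≢1+2r q r eq = absurd ℤ.∣ q ℤ.- r ∣ (trans (sym (ℤₚ.abs-* (q ℤ.- r) (+ 2)))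
  (cong ℤ.∣_∣ (trans (shuffle q r) (trans (cong (ℤ._- r ℤ.* + 2) eq) (shuffle′ r)))))
  where
  absurd : ∀ k → ¬ k ℕ.* 2 ≡ 1
  absurd zero ()
  absurd (suc k) ()
  shuffle : ∀ q r → (q ℤ.- r) ℤ.* + 2 ≡ + 0 ℤ.+ q ℤ.* + 2 ℤ.- r ℤ.* + 2
  shuffle = solve-∀
  shuffle′ : ∀ r → + 1 ℤ.+ r ℤ.* + 2 ℤ.- r ℤ.* + 2 ≡ + 1
  shuffle′ = solve-∀

÷2-unique : ∀ q r q′ r′ → r ℕ.< 2 → r′ ℕ.< 2 → + r ℤ.+ q ℤ.* + 2 ≡ + r′ ℤ.+ q′ ℤ.* + 2 → r ≡ r′ × q ≡ q′
÷2-unique q 0 q′ 0 _ _ eq = refl , ℤₚ.*-cancelʳ-≡ q q′ (+ 2) (+-cancelˡ (+ 0) _ _ eq)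
÷2-unique q 0 q′ 1 _ _ eq = contradiction eq (0+2q≢1+2r q q′)
÷2-unique q 1 q′ 0 _ _ eq = contradiction (sym eq) (0+2q≢1+2r q′ q)
÷2-unique q 1 q′ 1 _ _ eq = refl , ℤₚ.*-cancelʳ-≡ q q′ (+ 2) (+-cancelˡ (+ 1) _ _ eq)
÷2-unique q (suc (suc _)) q′ _ (ℕ.s≤s (ℕ.s≤s ())) _ _
÷2-unique q _ q′ (suc (suc _)) _ (ℕ.s≤s (ℕ.s≤s ())) _

divMod-2 : ∀ n q r → r ℕ.< 2 → n ≡ + r ℤ.+ q ℤ.* + 2 → n ℤ.%ℕ 2 ≡ r × n ℤ./ℕ 2 ≡ q
divMod-2 n q r r<2 eq = ÷2-unique (n ℤ./ℕ 2) (n ℤ.%ℕ 2) q r (ℤᵈ.n%ℕd<d n 2) r<2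
  (trans (sym (ℤᵈ.a≡a%ℕn+[a/ℕn]*n n 2)) eq)

canonical-even : ∀ k q → canonical (q ℤ.* + 2) (suc k) ≡ canonical q k
canonical-even k q = uncurry (go (q ℤ.* + 2))
  (divMod-2 (q ℤ.* + 2) q 0 (ℕ.s≤s ℕ.z≤n) (sym (ℤₚ.+-identityˡ (q ℤ.* + 2))))
  where
  -- `canonical` branches on `n %ℕ 2`; with a variable `n`, its remainder and quotient given by
  -- equations, that term can be abstracted.
  go : ∀ n → n ℤ.%ℕ 2 ≡ 0 → n ℤ./ℕ 2 ≡ q → canonical n (suc k) ≡ canonical q k
  go n rem refl with n ℤ.%ℕ 2 | rem
  ... | _ | refl = refl

canonical-odd : ∀ k q →
  canonical (+ 1 ℤ.+ q ℤ.* + 2) (suc k) ≡ between (canonical q k) (canonical (ℤ.suc q) k)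
canonical-odd k q = uncurry (go (+ 1 ℤ.+ q ℤ.* + 2))
  (divMod-2 (+ 1 ℤ.+ q ℤ.* + 2) q 1 (ℕ.s≤s (ℕ.s≤s ℕ.z≤n)) refl)
  where
  go : ∀ n → n ℤ.%ℕ 2 ≡ 1 → n ℤ./ℕ 2 ≡ q →
    canonical n (suc k) ≡ between (canonical q k) (canonical (ℤ.suc q) k)
  go n rem refl with n ℤ.%ℕ 2 | rem
  ... | _ | refl = refl

canonical-scale : ∀ k → Scale (λ n → canonical n k)
canonical-scale zero    = integer-scale
canonical-scale (suc k) = Halving.halved (canonical-scale k) (canonical-even k) (canonical-odd k)

-- The recursion strips each factor 2, so an unreduced fraction yields the very same formal game.
-- Numbers with different exponents can therefore be compared at one common scale.
canonical-lift : ∀ d n k → canonical (n ℤ.* + (2 ℕ.^ d)) (d ℕ.+ k) ≡ canonical n k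
canonical-lift zero    n k = cong (λ n → canonical n k) (ℤₚ.*-identityʳ n)
canonical-lift (suc d) n k = trans (cong (λ n → canonical n (suc (d ℕ.+ k)))
    (trans (cong (n ℤ.*_) (ℤₚ.pos-* 2 (2 ℕ.^ d))) (shuffle n (+ (2 ℕ.^ d)))))
  (trans (canonical-even (d ℕ.+ k) (n ℤ.* + (2 ℕ.^ d))) (canonical-lift d n k))
  where
  shuffle : ∀ n p → n ℤ.* (+ 2 ℤ.* p) ≡ n ℤ.* p ℤ.* + 2
  shuffle = solve-∀

-- 2ᵏ x, an integer when exponent x ≤ k.
coordinate : ℕ → ℤ[½] → ℤ
coordinate k x = ↥ value x ℤ.* + (2 ℕ.^ (k ℕ.∸ exponent x))

canonical-coordinate : ∀ k x → exponent x ℕ.≤ k → canonical (coordinate k x) k ≡ ⌜ x ⌝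
canonical-coordinate k x e≤k = trans
  (cong (canonical (coordinate k x)) (sym (ℕₚ.m∸n+n≡m e≤k)))
  (canonical-lift (k ℕ.∸ exponent x) (↥ value x) (exponent x))

value-coordinate : ∀ k x → exponent x ℕ.≤ k →
  value x ℚ.* fromℤ (+ (2 ℕ.^ k)) ≡ fromℤ (coordinate k x)
value-coordinate k x@(dyadic v@(mkℚ n d c) e _) e≤k = ℚₚ.toℚᵘ-injective
  (ℚᵘₚ.≃-trans (ℚₚ.toℚᵘ-homo-* v (fromℤ (+ (2 ℕ.^ k)))) (ℚᵘ.*≡* (begin
    n ℤ.* + (2 ℕ.^ k) ℤ.* + 1                          ≡⟨ cong (λ p → n ℤ.* p ℤ.* + 1) split ⟩
    n ℤ.* (+ (2 ℕ.^ (k ℕ.∸ e)) ℤ.* + suc d) ℤ.* + 1    ≡⟨ shuffle n (+ (2 ℕ.^ (k ℕ.∸ e))) (+ suc d) ⟩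
    n ℤ.* + (2 ℕ.^ (k ℕ.∸ e)) ℤ.* (+ suc d ℤ.* + 1)    ∎)))
  where
  open ≡-Reasoning
  shuffle : ∀ n p q → n ℤ.* (p ℤ.* q) ℤ.* + 1 ≡ n ℤ.* p ℤ.* (q ℤ.* + 1)
  shuffle = solve-∀
  split : + (2 ℕ.^ k) ≡ + (2 ℕ.^ (k ℕ.∸ e)) ℤ.* + suc d
  split = begin
    + (2 ℕ.^ k)                              ≡⟨ cong (λ m → + (2 ℕ.^ m)) (ℕₚ.m∸n+n≡m e≤k) ⟨
    + (2 ℕ.^ (k ℕ.∸ e ℕ.+ e))                ≡⟨ cong +_ (ℕₚ.^-distribˡ-+-* 2 (k ℕ.∸ e) e) ⟩
    + (2 ℕ.^ (k ℕ.∸ e) ℕ.* 2 ℕ.^ e)          ≡⟨ ℤₚ.pos-* (2 ℕ.^ (k ℕ.∸ e)) (2 ℕ.^ e) ⟩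
    + (2 ℕ.^ (k ℕ.∸ e)) ℤ.* + (2 ℕ.^ e)      ≡⟨ cong (λ m → + (2 ℕ.^ (k ℕ.∸ e)) ℤ.* + m) (denom x) ⟨
    + (2 ℕ.^ (k ℕ.∸ e)) ℤ.* + suc d          ∎

coordinate-mono : ∀ k x y → exponent x ℕ.≤ k → exponent y ℕ.≤ k → x ≤ y → coordinate k x ℤ.≤ coordinate k y
coordinate-mono k x y ex ey x≤y = fromInt-cancel
  (subst₂ ℚ._≤_ (value-coordinate k x ex) (value-coordinate k y ey)
    (ℚₚ.*-monoʳ-≤-nonNeg (fromℤ (+ (2 ℕ.^ k))) x≤y))

coordinate-cancel : ∀ k x y → exponent x ℕ.≤ k → exponent y ℕ.≤ k → coordinate k x ℤ.≤ coordinate k y → x ≤ y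
coordinate-cancel k x y ex ey c≤c = ℚₚ.*-cancelʳ-≤-pos (fromℤ (+ (2 ℕ.^ k)))
  {{ℚ.positive (2^-pos (2 ℕ.^ k) (ℕₚ.m^n>0 2 k))}}
  (subst₂ ℚ._≤_ (sym (value-coordinate k x ex)) (sym (value-coordinate k y ey)) (fromInt-mono c≤c))
  where
  2^-pos : ∀ n → 0 ℕ.< n → 0ℚ ℚ.< fromℤ (+ n)
  2^-pos (suc n) _ = ℚₚ.positive⁻¹ (fromℤ (+ suc n))

coordinate-+ : ∀ k x y → exponent x ℕ.≤ k → exponent y ℕ.≤ k →
  coordinate k (x + y) ≡ coordinate k x ℤ.+ coordinate k y
coordinate-+ k x y ex ey = cong ↥_ (begin
  fromℤ (coordinate k (x + y))                       ≡⟨ value-coordinate k (x + y) exy ⟨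
  (value x ℚ.+ value y) ℚ.* p                        ≡⟨ ℚₚ.*-distribʳ-+ p (value x) (value y) ⟩
  value x ℚ.* p ℚ.+ value y ℚ.* p
    ≡⟨ cong₂ ℚ._+_ (value-coordinate k x ex) (value-coordinate k y ey) ⟩
  fromℤ (coordinate k x) ℚ.+ fromℤ (coordinate k y)  ≡⟨ fromℤ-+ (coordinate k x) (coordinate k y) ⟨
  fromℤ (coordinate k x ℤ.+ coordinate k y)          ∎)
  where
  open ≡-Reasoning
  p : ℚ
  p = fromℤ (+ (2 ℕ.^ k))
  exy : exponent (x + y) ℕ.≤ k
  exy = ℕₚ.≤-trans (exponent-+ x y) (ℕₚ.⊔-lub ex ey)

coordinate-1/2^ : ∀ k → coordinate k (1/2^ k) ≡ + 1
coordinate-1/2^ k = cong₂ (λ n d → n ℤ.* + (2 ℕ.^ d)) (numerator (2 ℕ.^ k) {{ℕₚ.m^n≢0 2 k}}) (ℕₚ.n∸n≡0 k)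
  where
  numerator : ∀ d .{{_ : ℕ.NonZero d}} → ↥ unitFraction d ≡ + 1
  numerator (suc d) = refl

module _ (x y : ℤ[½]) where
  private
    k : ℕ
    k = exponent x ℕ.⊔ exponent y
    ex : exponent x ℕ.≤ k
    ex = ℕₚ.m≤m⊔n (exponent x) (exponent y)
    ey : exponent y ℕ.≤ k
    ey = ℕₚ.m≤n⊔m (exponent x) (exponent y)
    open Scale (canonical-scale k)
    -- Cancellation may give x + y an exponent smaller than `k`; `canonical-coordinate` allows for
    -- this.
    sum-≡ : canonical (coordinate k x ℤ.+ coordinate k y) k ≡ ⌜ x + y ⌝
    sum-≡ = trans (cong (λ n → canonical n k) (sym (coordinate-+ k x y ex ey)))
      (canonical-coordinate k (x + y) (exponent-+ x y))

  ⌜⌝-mono : x ≤ y → ⌜ y ⌝ ≥ᴳ ⌜ x ⌝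
  ⌜⌝-mono x≤y = subst₂ _≥ᴳ_ (canonical-coordinate k y ey) (canonical-coordinate k x ex)
    (mono (coordinate-mono k x y ex ey x≤y))

  ⌜⌝-+-≥ : ⌜ x ⌝ ⊕ ⌜ y ⌝ ≥ᴳ ⌜ x + y ⌝
  ⌜⌝-+-≥ = subst₂ _≥ᴳ_ (cong₂ _⊕_ (canonical-coordinate k x ex) (canonical-coordinate k y ey)) sum-≡
    (superadditive (coordinate k x) (coordinate k y))

  ≥-⌜⌝-+ : ⌜ x + y ⌝ ≥ᴳ ⌜ x ⌝ ⊕ ⌜ y ⌝
  ≥-⌜⌝-+ = subst₂ _≥ᴳ_ sum-≡ (cong₂ _⊕_ (canonical-coordinate k x ex) (canonical-coordinate k y ey))
    (subadditive (coordinate k x) (coordinate k y))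

  ⌜⌝-cancel : ⌜ y ⌝ ≥ᴳ ⌜ x ⌝ → x ≤ y
  ⌜⌝-cancel y≥x = ℚₚ.≮⇒≥ λ y<x → ≥⇒⋫ ⌜ y ⌝ ⌜ x ⌝ y≥x
    (subst₂ _▷_ (canonical-coordinate k x ex) (canonical-coordinate k y ey)
      (strict-mono (ℤₚ.≰⇒> λ cx≤cy → ≤⇒≯ (coordinate-cancel k x y ex ey cx≤cy) y<x)))

x-y+y≡x : ∀ x y → x - y + y ≡ x
x-y+y≡x x y = ≡-value (x - y + y) x (ring (value x) (value y))
  where
  ring : ∀ x y → x ℚ.- y ℚ.+ y ≡ x
  ring = RingSolver.solve-∀ ℚ-ring

⊖⌜⌝-≥ : ∀ G t y → G ≥ᴳ ⌜ y + t ⌝ → G ⊖ ⌜ t ⌝ ≥ᴳ ⌜ y ⌝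
⊖⌜⌝-≥ G t y p = ≥-⊕⇒⊖-≥ G ⌜ t ⌝ ⌜ y ⌝ (≥-trans G ⌜ y + t ⌝ (⌜ y ⌝ ⊕ ⌜ t ⌝) p (≥-⌜⌝-+ y t))

⊖⌜⌝-≥⁻¹ : ∀ G t y → G ⊖ ⌜ t ⌝ ≥ᴳ ⌜ y ⌝ → G ≥ᴳ ⌜ y + t ⌝
⊖⌜⌝-≥⁻¹ G t y p = ≥-trans G (⌜ y ⌝ ⊕ ⌜ t ⌝) ⌜ y + t ⌝ (⊖-≥⇒≥-⊕ G ⌜ t ⌝ ⌜ y ⌝ p) (⌜⌝-+-≥ y t)

≥-⊕⌜⌝ : ∀ G t y → ⌜ y - t ⌝ ≥ᴳ G → ⌜ y ⌝ ≥ᴳ G ⊕ ⌜ t ⌝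
≥-⊕⌜⌝ G t y p = subst (λ z → ⌜ z ⌝ ≥ᴳ G ⊕ ⌜ t ⌝) (x-y+y≡x y t)
  (≥-trans ⌜ y - t + t ⌝ (⌜ y - t ⌝ ⊕ ⌜ t ⌝) (G ⊕ ⌜ t ⌝) (≥-⌜⌝-+ (y - t) t) (⊕-monoˡ ⌜ y - t ⌝ G ⌜ t ⌝ p))

≥-⊕⌜⌝⁻¹ : ∀ G t y → ⌜ y ⌝ ≥ᴳ G ⊕ ⌜ t ⌝ → ⌜ y - t ⌝ ≥ᴳ G
≥-⊕⌜⌝⁻¹ G t y p = ⊕-cancelʳ ⌜ y - t ⌝ G ⌜ t ⌝ (≥-trans (⌜ y - t ⌝ ⊕ ⌜ t ⌝) ⌜ y ⌝ (G ⊕ ⌜ t ⌝)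
  (subst (λ z → ⌜ y - t ⌝ ⊕ ⌜ t ⌝ ≥ᴳ ⌜ z ⌝) (x-y+y≡x y t) (⌜⌝-+-≥ (y - t) t)) p)

module _ (x : ℤ[½]) where
  private
    k : ℕ
    k = exponent x
    open Scale (canonical-scale k)

    coordinate-suc : ∀ y → exponent y ℕ.≤ k → coordinate k (y + 1/2^ k) ≡ ℤ.suc (coordinate k y)
    coordinate-suc y ey = trans (coordinate-+ k y (1/2^ k) ey ℕₚ.≤-refl)
      (trans (cong (λ n → coordinate k y ℤ.+ n) (coordinate-1/2^ k)) (ℤₚ.+-comm (coordinate k y) (+ 1)))

    canonical-x : canonical (coordinate k x) k ≡ ⌜ x ⌝
    canonical-x = canonical-coordinate k x ℕₚ.≤-refl

  -- Options of a number with denominator 2ᵏ stay at least 2⁻ᵏ away from it. This gap turns a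
  -- comparison with an option into one with a strictly smaller number `w`.
  left-⌜⌝-< : ∀ i → ∃ λ w → w < x × ⌜ w ⌝ ≥ᴳ left ⌜ x ⌝ i
  left-⌜⌝-< i = w , w<x , subst₂ (λ G H → ∀ i → G ≥ᴳ left H i)
    (canonical-coordinate k w ew)
    (trans (cong (λ n → canonical n k) (trans (sym (coordinate-suc w ew)) (cong (coordinate k) (x-y+y≡x x (1/2^ k)))))
      canonical-x)
    (lefts (coordinate k w)) i
    where
    w : ℤ[½]
    w = x - 1/2^ k
    ew : exponent w ℕ.≤ k
    ew = ℕₚ.≤-trans (exponent-+ x (- 1/2^ k)) (ℕₚ.⊔-lub ℕₚ.≤-refl ℕₚ.≤-refl)
    w<x : w < x
    w<x = <-shift (1/2^-pos k) (ring (value x) (value (1/2^ k)))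
      where
      ring : ∀ x h → x ℚ.- h ℚ.- x ≡ 0ℚ ℚ.- h
      ring = RingSolver.solve-∀ ℚ-ring

  right-⌜⌝-> : ∀ j → ∃ λ w → x < w × right ⌜ x ⌝ j ≥ᴳ ⌜ w ⌝
  right-⌜⌝-> j = w , x<w , subst₂ (λ G H → ∀ j → right G j ≥ᴳ H) canonical-x
    (trans (cong (λ n → canonical n k) (sym (coordinate-suc x ℕₚ.≤-refl))) (canonical-coordinate k w ew))
    (rights (coordinate k x)) j
    where
    w : ℤ[½]
    w = x + 1/2^ k
    ew : exponent w ℕ.≤ k
    ew = ℕₚ.≤-trans (exponent-+ x (1/2^ k)) (ℕₚ.⊔-lub ℕₚ.≤-refl ℕₚ.≤-refl)
    x<w : x < w
    x<w = <-shift (1/2^-pos k) (ring (value x) (value (1/2^ k)))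
      where
      ring : ∀ x h → x ℚ.- (x ℚ.+ h) ≡ 0ℚ ℚ.- h
      ring = RingSolver.solve-∀ ℚ-ring

-- Comparing cooled games with numbers

lam-falling : ∀ G → Falling (Thermograph.order (thermograph G)) (lam G)
lam-falling G = Thermograph.falling (thermograph G)

rho-rising : ∀ G → Rising (Thermograph.order (thermograph G)) (rho G)
rho-rising G = Thermograph.rising (thermograph G)

rho≤lam : ∀ G t → rho G t ≤ lam G t
rho≤lam G t = ℚₚ.≤-trans (Thermograph.right≤mast (thermograph G) t) (Thermograph.mast≤left (thermograph G) t)

-- `frozen` covers games equal to an integer and all t above the temperature. Its last field says
-- that both scores are flat just before t; it will exclude slope 1 of ρ and slope -1 of λ. `active`
-- records the scores at every s ≤ t because later arguments compare two points.
data Phase (G : Game) (t : ℤ[½]) : Set where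
  frozen : cool G t ≡ ⌜ rho G t ⌝ → lam G t ≡ rho G t →
    (∀ s → s < t → ∃ λ u → s ≤ u × u < t × lam G u ≡ lam G t × rho G u ≡ rho G t) → Phase G t
  active : LeftOption G → RightOption G → cool G t ≡ cool~ G t →
    (∀ s → s ≤ t → lam G s ≡ lam~ G s × rho G s ≡ rho~ G s) → Phase G t

leftOption : ∀ G → ¬ IsInteger G → LeftOption G
leftOption (game L R) = hasLeftOption L R

rightOption : ∀ G → ¬ IsInteger G → RightOption G
rightOption (game L R) = hasRightOption L R

phase : ∀ G t → Phase G t
phase G t = byCases (isInteger? G)
  where
  byTemperature : ∀ τ → ¬ IsInteger G → lam~ G τ ≡ rho~ G τ →
    (∀ t → t ≤ τ → lam G t ≡ lam~ G t × rho G t ≡ rho~ G t × cool G t ≡ cool~ G t) →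
    (∀ t → τ < t → lam G t ≡ lam~ G τ × rho G t ≡ lam~ G τ × cool G t ≡ ⌜ lam~ G τ ⌝) →
    Dec (t ≤ τ) → Phase G t
  byTemperature τ ¬int meet before after (yes t≤τ) =
    active (leftOption G ¬int) (rightOption G ¬int) (proj₂ (proj₂ (before t t≤τ)))
      λ s s≤t → let l , r , _ = before s (ℚₚ.≤-trans s≤t t≤τ) in l , r
  byTemperature τ ¬int meet before after (no t≰τ) =
    frozen (trans cool≡ (cong ⌜_⌝ (sym rho≡))) (trans lam≡ (sym rho≡)) earlier
    where
    τ<t : τ < t
    τ<t = ℚₚ.≰⇒> t≰τ
    lam≡ : lam G t ≡ lam~ G τ
    lam≡ = proj₁ (after t τ<t)
    rho≡ : rho G t ≡ lam~ G τ
    rho≡ = proj₁ (proj₂ (after t τ<t))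
    cool≡ : cool G t ≡ ⌜ lam~ G τ ⌝
    cool≡ = proj₂ (proj₂ (after t τ<t))
    earlier : ∀ s → s < t → ∃ λ u → s ≤ u × u < t × lam G u ≡ lam G t × rho G u ≡ rho G t
    earlier s s<t with s ≤? τ
    ... | yes s≤τ = let l , r , _ = before τ ℚₚ.≤-refl in
      τ , s≤τ , τ<t , trans l (sym lam≡) , trans r (trans (sym meet) (sym rho≡))
    ... | no s≰τ = let l , r , _ = after s (ℚₚ.≰⇒> s≰τ) in
      s , ℚₚ.≤-refl , s<t , trans l (sym lam≡) , trans r (sym rho≡)
  byCases : Dec (IsInteger G) → Phase G t
  byCases (yes (n , G≈n)) = let _ , scores = integer-clause G n G≈n ; l , r , c = scores t in
    frozen (trans c (cong ⌜_⌝ (sym r))) (trans l (sym r)) λ s s<t → let l′ , r′ , _ = scores s in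
      s , ℚₚ.≤-refl , s<t , trans l′ (sym l) , trans r′ (sym r)
  byCases (no ¬int) = let τ , _ , (meet , _) , before , after = noninteger-clause G ¬int in
    byTemperature τ ¬int meet before after (t ≤? τ)

≤-lam~ : ∀ G t i → rho (left G i) t - t ≤ lam~ G t
≤-lam~ (game L R) t = ≤-maximum (λ i → rho (L i) t - t)

rho~-≤ : ∀ G t j → rho~ G t ≤ lam (right G j) t + t
rho~-≤ (game L R) t = minimum-≤ (λ j → lam (R j) t + t)

lam~-selects : ∀ G t → LeftOption G → ∃ λ i → lam~ G t ≡ rho (left G i) t - t
lam~-selects (game L R) t = maximum-selects (λ i → rho (L i) t - t)

rho~-selects : ∀ G t → RightOption G → ∃ λ j → rho~ G t ≡ lam (right G j) t + t
rho~-selects (game L R) t = minimum-selects (λ j → lam (R j) t + t)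

≤-move : ∀ x y z → x ℚ.- z ℚ.≤ y → x ℚ.≤ y ℚ.+ z
≤-move x y z p = ≤-shift p (ring x y z)
  where
  ring : ∀ x y z → x ℚ.- (y ℚ.+ z) ≡ x ℚ.- z ℚ.- y
  ring = RingSolver.solve-∀ ℚ-ring

≤-move⁻¹ : ∀ x y z → x ℚ.≤ y ℚ.+ z → x ℚ.- z ℚ.≤ y
≤-move⁻¹ x y z p = ≤-shift p (ring x y z)
  where
  ring : ∀ x y z → x ℚ.- z ℚ.- y ≡ x ℚ.- (y ℚ.+ z)
  ring = RingSolver.solve-∀ ℚ-ring

≤-moveʳ : ∀ x y z → x ℚ.≤ y ℚ.- z → x ℚ.+ z ℚ.≤ y
≤-moveʳ x y z p = ≤-shift p (ring x y z)
  where
  ring : ∀ x y z → x ℚ.+ z ℚ.- y ≡ x ℚ.- (y ℚ.- z)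
  ring = RingSolver.solve-∀ ℚ-ring

≤-moveʳ⁻¹ : ∀ x y z → x ℚ.+ z ℚ.≤ y → x ℚ.≤ y ℚ.- z
≤-moveʳ⁻¹ x y z p = ≤-shift p (ring x y z)
  where
  ring : ∀ x y z → x ℚ.- (y ℚ.- z) ≡ x ℚ.+ z ℚ.- y
  ring = RingSolver.solve-∀ ℚ-ring

mutual
  -- Induction jointly with `≥-cool⇒lam≤`. In the active case a cooled Right option, plus t, at or
  -- below z would by that companion have λ + t ≤ z, although each such sum is at least ρ_t(G) > z.
  <rho⇒cool-≥ : ∀ G t z → z < rho G t → cool G t ≥ᴳ ⌜ z ⌝
  <rho⇒cool-≥ G t z z<ρ = <rho⇒cool-≥′ G t z z<ρ (phase G t)

  <rho⇒cool-≥′ : ∀ G t z → z < rho G t → Phase G t → cool G t ≥ᴳ ⌜ z ⌝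
  <rho⇒cool-≥′ G t z z<ρ (frozen cool≡ _ _) =
    subst (_≥ᴳ ⌜ z ⌝) (sym cool≡) (⌜⌝-mono z (rho G t) (ℚₚ.<⇒≤ z<ρ))
  <rho⇒cool-≥′ G@(game L R) t z z<ρ (active i₀ _ cool≡ scores≡) =
    let lam≡ , rho≡ = scores≡ t ℚₚ.≤-refl in
    subst (_≥ᴳ ⌜ z ⌝) (sym cool≡) (cool~-≥ G t z i₀
      (subst (λ x → z ≤ x) lam≡ (ℚₚ.≤-trans (ℚₚ.<⇒≤ z<ρ) (rho≤lam G t)))
      (λ j p → ≤⇒≯ (ℚₚ.≤-trans (rho~-≤ G t j)
          (≤-moveʳ (value (lam (R j) t)) (value z) (value t)
            (≥-cool⇒lam≤ (R j) t (z - t) (≥-⊕⌜⌝⁻¹ (cool (R j) t) t z p))))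
        (subst (λ x → z < x) rho≡ z<ρ)))

  -- A Left option of `⌜ z ⌝` lies below some w < z, and w at or above `cool~ G t` would force
  -- `lam~` ≤ w < z. Thus z ≤ `lam~` may be an equality and only the Right options remain to be
  -- checked, which allows reuse at z = `rho~ G t`.
  cool~-≥ : ∀ G t z → LeftOption G → z ≤ lam~ G t → (∀ j → ⌜ z ⌝ ⊲∣ right (cool~ G t) j) → cool~ G t ≥ᴳ ⌜ z ⌝
  cool~-≥ G t z i₀ z≤λ rights = ≥-intro (cool~ G t) ⌜ z ⌝
    (λ j → ≱⇒▷ ⌜ z ⌝ (right (cool~ G t) j) (rights j))
    (λ i → ≱⇒▷ (left ⌜ z ⌝ i) (cool~ G t) λ p → let w , w<z , w≥ = left-⌜⌝-< z i in
      ≤⇒≯ (ℚₚ.≤-trans z≤λ (≥-cool~⇒lam~≤ G t w i₀ (≥-trans ⌜ w ⌝ (left ⌜ z ⌝ i) (cool~ G t) w≥ p))) w<z)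

  -- If the Left option attaining the maximum had ρ_t > y + t, Left could move to it and reach at
  -- least y.
  ≥-cool~⇒lam~≤ : ∀ G t y → LeftOption G → ⌜ y ⌝ ≥ᴳ cool~ G t → lam~ G t ≤ y
  ≥-cool~⇒lam~≤ G@(game L R) t y i₀ p = let i , eq = lam~-selects G t i₀ in
    subst (λ x → x ≤ y) (sym eq) (≤-move⁻¹ (value (rho (L i) t)) (value y) (value t)
      (ℚₚ.≮⇒≥ λ y+t<ρ → ≥⇒⋫ (cool (L i) t ⊖ ⌜ t ⌝) ⌜ y ⌝
        (⊖⌜⌝-≥ (cool (L i) t) t y (<rho⇒cool-≥ (L i) t (y + t) y+t<ρ)) (≥-left ⌜ y ⌝ (cool~ G t) p i)))

  ≥-cool⇒lam≤ : ∀ G t y → ⌜ y ⌝ ≥ᴳ cool G t → lam G t ≤ y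
  ≥-cool⇒lam≤ G t y p = ≥-cool⇒lam≤′ G t y p (phase G t)

  ≥-cool⇒lam≤′ : ∀ G t y → ⌜ y ⌝ ≥ᴳ cool G t → Phase G t → lam G t ≤ y
  ≥-cool⇒lam≤′ G t y p (frozen cool≡ lam≡ _) = subst (λ x → x ≤ y) (sym lam≡)
    (⌜⌝-cancel (rho G t) y (subst (⌜ y ⌝ ≥ᴳ_) cool≡ p))
  ≥-cool⇒lam≤′ G t y p (active i₀ _ cool≡ scores≡) = subst (λ x → x ≤ y)
    (sym (proj₁ (scores≡ t ℚₚ.≤-refl))) (≥-cool~⇒lam~≤ G t y i₀ (subst (⌜ y ⌝ ≥ᴳ_) cool≡ p))

mutual
  -- This block is the previous one with the players exchanged.
  lam<⇒≥-cool : ∀ G t z → lam G t < z → ⌜ z ⌝ ≥ᴳ cool G t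
  lam<⇒≥-cool G t z λ<z = lam<⇒≥-cool′ G t z λ<z (phase G t)

  lam<⇒≥-cool′ : ∀ G t z → lam G t < z → Phase G t → ⌜ z ⌝ ≥ᴳ cool G t
  lam<⇒≥-cool′ G t z λ<z (frozen cool≡ lam≡ _) =
    subst (⌜ z ⌝ ≥ᴳ_) (sym cool≡) (⌜⌝-mono (rho G t) z (ℚₚ.≤-trans (rho≤lam G t) (ℚₚ.<⇒≤ λ<z)))
  lam<⇒≥-cool′ G@(game L R) t z λ<z (active _ j₀ cool≡ scores≡) =
    let lam≡ , rho≡ = scores≡ t ℚₚ.≤-refl in
    subst (⌜ z ⌝ ≥ᴳ_) (sym cool≡) (≥-cool~ G t z j₀
      (subst (λ x → x ≤ z) rho≡ (ℚₚ.≤-trans (rho≤lam G t) (ℚₚ.<⇒≤ λ<z)))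
      (λ i p → ≤⇒≯ (ℚₚ.≤-trans
          (≤-moveʳ⁻¹ (value z) (value (rho (L i) t)) (value t)
            (cool-≥⇒≤rho (L i) t (z + t) (⊖⌜⌝-≥⁻¹ (cool (L i) t) t z p)))
          (≤-lam~ G t i))
        (subst (λ x → x < z) lam≡ λ<z)))

  ≥-cool~ : ∀ G t z → RightOption G → rho~ G t ≤ z → (∀ i → left (cool~ G t) i ⊲∣ ⌜ z ⌝) → ⌜ z ⌝ ≥ᴳ cool~ G t
  ≥-cool~ G t z j₀ ρ≤z lefts = ≥-intro ⌜ z ⌝ (cool~ G t)
    (λ j → ≱⇒▷ (cool~ G t) (right ⌜ z ⌝ j) λ p → let w , z<w , ≥w = right-⌜⌝-> z j in
      ≤⇒≯ (ℚₚ.≤-trans (cool~-≥⇒≤rho~ G t w j₀ (≥-trans (cool~ G t) (right ⌜ z ⌝ j) ⌜ w ⌝ p ≥w)) ρ≤z) z<w)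
    (λ i → ≱⇒▷ (left (cool~ G t) i) ⌜ z ⌝ (lefts i))

  cool~-≥⇒≤rho~ : ∀ G t y → RightOption G → cool~ G t ≥ᴳ ⌜ y ⌝ → y ≤ rho~ G t
  cool~-≥⇒≤rho~ G@(game L R) t y j₀ p = let j , eq = rho~-selects G t j₀ in
    subst (λ x → y ≤ x) (sym eq) (≤-move (value y) (value (lam (R j) t)) (value t)
      (ℚₚ.≮⇒≥ λ λ<y-t → ≥⇒⋫ ⌜ y ⌝ (cool (R j) t ⊕ ⌜ t ⌝)
        (≥-⊕⌜⌝ (cool (R j) t) t y (lam<⇒≥-cool (R j) t (y - t) λ<y-t)) (≥-right (cool~ G t) ⌜ y ⌝ p j)))

  cool-≥⇒≤rho : ∀ G t y → cool G t ≥ᴳ ⌜ y ⌝ → y ≤ rho G t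
  cool-≥⇒≤rho G t y p = cool-≥⇒≤rho′ G t y p (phase G t)

  cool-≥⇒≤rho′ : ∀ G t y → cool G t ≥ᴳ ⌜ y ⌝ → Phase G t → y ≤ rho G t
  cool-≥⇒≤rho′ G t y p (frozen cool≡ _ _) = ⌜⌝-cancel y (rho G t) (subst (_≥ᴳ ⌜ y ⌝) cool≡ p)
  cool-≥⇒≤rho′ G t y p (active _ j₀ cool≡ scores≡) = subst (λ x → y ≤ x)
    (sym (proj₂ (scores≡ t ℚₚ.≤-refl))) (cool~-≥⇒≤rho~ G t y j₀ (subst (_≥ᴳ ⌜ y ⌝) cool≡ p))

-- Comparing cooled games with their own scores

constant⇒not-rising : ∀ {x y} s t → s < t → x ≡ y → ¬ value x ℚ.- value s ℚ.≤ value y ℚ.- value t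
constant⇒not-rising {x} s t s<t refl p = ≤⇒≯ (≤-shift p (ring (value x) (value s) (value t))) s<t
  where
  ring : ∀ x s t → t ℚ.- s ≡ x ℚ.- s ℚ.- (x ℚ.- t)
  ring = RingSolver.solve-∀ ℚ-ring

constant⇒not-falling : ∀ {x y} s t → s < t → x ≡ y → ¬ value y ℚ.+ value t ℚ.≤ value x ℚ.+ value s
constant⇒not-falling {x} s t s<t refl p = ≤⇒≯ (≤-shift p (ring (value x) (value s) (value t))) s<t
  where
  ring : ∀ x s t → t ℚ.- s ≡ x ℚ.+ t ℚ.- (x ℚ.+ s)
  ring = RingSolver.solve-∀ ℚ-ring

mutual
  -- As ρ is nondecreasing, the hypothesis makes it constant on [s, t]; `steep` below likewise gives
  -- λ slope -1 there. Constant ρ of a game is reduced to steep λ of its Right options, and steep λ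
  -- to constant ρ of a Left option.
  rho-constant⇒cool-≥ : ∀ G s t → s < t → rho G t ≤ rho G s → cool G t ≥ᴳ ⌜ rho G t ⌝
  rho-constant⇒cool-≥ G s t s<t flat = rho-constant⇒cool-≥′ G s t s<t flat (phase G t)

  rho-constant⇒cool-≥′ : ∀ G s t → s < t → rho G t ≤ rho G s → Phase G t → cool G t ≥ᴳ ⌜ rho G t ⌝
  rho-constant⇒cool-≥′ G s t s<t flat (frozen cool≡ _ _) =
    subst (_≥ᴳ ⌜ rho G t ⌝) (sym cool≡) (≥-refl ⌜ rho G t ⌝)
  rho-constant⇒cool-≥′ G@(game L R) s t s<t flat (active i₀ _ cool≡ scores≡) =
    let lam≡ , rho≡ = scores≡ t ℚₚ.≤-refl in
    subst₂ (λ H x → H ≥ᴳ ⌜ x ⌝) (sym cool≡) (sym rho≡) (cool~-≥ G t (rho~ G t) i₀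
      (subst₂ _≤_ rho≡ lam≡ (rho≤lam G t))
      (rho~-constant⇒⊲∣ G s t s<t (subst₂ _≤_ rho≡ (proj₂ (scores≡ s (ℚₚ.<⇒≤ s<t))) flat)))

  -- If the inequality failed at `j`, then λ_t + t ≤ `rho~ G t` ≤ `rho~ G s` ≤ λ_s + s for that
  -- Right option. Its λ is then steep, and its cooled form lies at or below λ_t, which steepness
  -- forbids.
  rho~-constant⇒⊲∣ : ∀ G s t → s < t → rho~ G t ≤ rho~ G s →
    ∀ j → ⌜ rho~ G t ⌝ ⊲∣ right (cool~ G t) j
  rho~-constant⇒⊲∣ G@(game L R) s t s<t flat j p =
    lam-steep⇒≱-cool (R j) s t s<t
      (ℚₚ.≤-trans (≤-moveʳ (value λt) (value (rho~ G t)) (value t) (≥-cool⇒lam≤ (R j) t (rho~ G t - t) q))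
        (ℚₚ.≤-trans flat (rho~-≤ G s j)))
      (≥-trans ⌜ λt ⌝ ⌜ rho~ G t - t ⌝ (cool (R j) t)
        (⌜⌝-mono (rho~ G t - t) λt (≤-move⁻¹ (value (rho~ G t)) (value λt) (value t) (rho~-≤ G t j))) q)
    where
    λt : ℤ[½]
    λt = lam (R j) t
    q : ⌜ rho~ G t - t ⌝ ≥ᴳ cool (R j) t
    q = ≥-⊕⌜⌝⁻¹ (cool (R j) t) t (rho~ G t) p

  lam-steep⇒≱-cool : ∀ G s t → s < t → lam G t + t ≤ lam G s + s → ⌜ lam G t ⌝ ⊲∣ cool G t
  lam-steep⇒≱-cool G s t s<t steep = lam-steep⇒≱-cool′ G s t s<t steep (phase G t)

  lam-steep⇒≱-cool′ : ∀ G s t → s < t → lam G t + t ≤ lam G s + s → Phase G t → ⌜ lam G t ⌝ ⊲∣ cool G t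
  lam-steep⇒≱-cool′ G s t s<t steep (frozen _ _ earlier) _ =
    -- Steepness passes from [s, t] to [u, t], while λ has equal values at u and t.
    let u , s≤u , u<t , lam≡ , _ = earlier s s<t in
    constant⇒not-falling u t u<t lam≡ (ℚₚ.≤-trans steep (Falling.slope (lam-falling G) s u s≤u))
  lam-steep⇒≱-cool′ G@(game L R) s t s<t steep (active i₀ _ cool≡ scores≡) p =
    let lam≡ , _ = scores≡ t ℚₚ.≤-refl
        i , q = lam~-steep⇒≥ G s t s<t i₀
          (subst₂ (λ x y → x + t ≤ y + s) lam≡ (proj₁ (scores≡ s (ℚₚ.<⇒≤ s<t))) steep) in
    ≥⇒⋫ (left (cool~ G t) i) ⌜ lam~ G t ⌝ q
      (≥-left ⌜ lam~ G t ⌝ (cool~ G t) (subst₂ (λ x H → ⌜ x ⌝ ≥ᴳ H) lam≡ cool≡ p) i)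

  -- The option is chosen to attain the maximum at s, not at t. For it `lam~ G t` + t ≤ `lam~ G s` +
  -- s = ρ_s ≤ ρ_t ≤ `lam~ G t` + t, so it attains the maximum at t too and its ρ is constant in
  -- between.
  lam~-steep⇒≥ : ∀ G s t → s < t → LeftOption G → lam~ G t + t ≤ lam~ G s + s →
    ∃ λ i → left (cool~ G t) i ≥ᴳ ⌜ lam~ G t ⌝
  lam~-steep⇒≥ G@(game L R) s t s<t i₀ steep = let i , eq = lam~-selects G s i₀ in
    i , lam~-steep⇒≥-at G s t s<t steep i eq

  lam~-steep⇒≥-at : ∀ G s t → s < t → lam~ G t + t ≤ lam~ G s + s →
    ∀ i → lam~ G s ≡ rho (left G i) s - s → cool (left G i) t ⊖ ⌜ t ⌝ ≥ᴳ ⌜ lam~ G t ⌝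
  lam~-steep⇒≥-at G@(game L R) s t s<t steep i eq =
    ⊖⌜⌝-≥ (cool (L i) t) t (lam~ G t) (≥-trans (cool (L i) t) ⌜ rho (L i) t ⌝ ⌜ lam~ G t + t ⌝
      (rho-constant⇒cool-≥ (L i) s t s<t (ℚₚ.≤-trans
        (≤-move (value (rho (L i) t)) (value (lam~ G t)) (value t) (≤-lam~ G t i)) λt≤ρs))
      (⌜⌝-mono (lam~ G t + t) (rho (L i) t)
        (ℚₚ.≤-trans λt≤ρs (Rising.monotone (rho-rising (L i)) s t (ℚₚ.<⇒≤ s<t)))))
    where
    λt≤ρs : lam~ G t + t ≤ rho (L i) s
    λt≤ρs = ℚₚ.≤-trans steep
      (≤-moveʳ (value (lam~ G s)) (value (rho (L i) s)) (value s) (ℚₚ.≤-reflexive (cong value eq)))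

mutual
  -- Again the exchange of players: constant λ is reduced to steep ρ of the Left options, and steep
  -- ρ to constant λ of a Right option.
  lam-constant⇒≥-cool : ∀ G s t → s < t → lam G s ≤ lam G t → ⌜ lam G t ⌝ ≥ᴳ cool G t
  lam-constant⇒≥-cool G s t s<t flat = lam-constant⇒≥-cool′ G s t s<t flat (phase G t)

  lam-constant⇒≥-cool′ : ∀ G s t → s < t → lam G s ≤ lam G t → Phase G t → ⌜ lam G t ⌝ ≥ᴳ cool G t
  lam-constant⇒≥-cool′ G s t s<t flat (frozen cool≡ lam≡ _) =
    subst₂ (λ x H → ⌜ x ⌝ ≥ᴳ H) (sym lam≡) (sym cool≡) (≥-refl ⌜ rho G t ⌝)
  lam-constant⇒≥-cool′ G@(game L R) s t s<t flat (active _ j₀ cool≡ scores≡) =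
    let lam≡ , rho≡ = scores≡ t ℚₚ.≤-refl in
    subst₂ (λ x H → ⌜ x ⌝ ≥ᴳ H) (sym lam≡) (sym cool≡) (≥-cool~ G t (lam~ G t) j₀
      (subst₂ _≤_ rho≡ lam≡ (rho≤lam G t))
      (lam~-constant⇒⊲∣ G s t s<t (subst₂ _≤_ (proj₁ (scores≡ s (ℚₚ.<⇒≤ s<t))) lam≡ flat)))

  lam~-constant⇒⊲∣ : ∀ G s t → s < t → lam~ G s ≤ lam~ G t →
    ∀ i → left (cool~ G t) i ⊲∣ ⌜ lam~ G t ⌝
  lam~-constant⇒⊲∣ G@(game L R) s t s<t flat i p =
    rho-steep⇒cool-≱ (L i) s t s<t
      (ℚₚ.≤-trans (≤-lam~ G s i) (ℚₚ.≤-trans flat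
        (≤-moveʳ⁻¹ (value (lam~ G t)) (value ρt) (value t) (cool-≥⇒≤rho (L i) t (lam~ G t + t) q))))
      (≥-trans (cool (L i) t) ⌜ lam~ G t + t ⌝ ⌜ ρt ⌝ q
        (⌜⌝-mono ρt (lam~ G t + t) (≤-move (value ρt) (value (lam~ G t)) (value t) (≤-lam~ G t i))))
    where
    ρt : ℤ[½]
    ρt = rho (L i) t
    q : cool (L i) t ≥ᴳ ⌜ lam~ G t + t ⌝
    q = ⊖⌜⌝-≥⁻¹ (cool (L i) t) t (lam~ G t) p

  rho-steep⇒cool-≱ : ∀ G s t → s < t → rho G s - s ≤ rho G t - t → cool G t ⊲∣ ⌜ rho G t ⌝
  rho-steep⇒cool-≱ G s t s<t steep = rho-steep⇒cool-≱′ G s t s<t steep (phase G t)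

  rho-steep⇒cool-≱′ : ∀ G s t → s < t → rho G s - s ≤ rho G t - t → Phase G t → cool G t ⊲∣ ⌜ rho G t ⌝
  rho-steep⇒cool-≱′ G s t s<t steep (frozen _ _ earlier) _ =
    let u , s≤u , u<t , _ , rho≡ = earlier s s<t in
    constant⇒not-rising u t u<t rho≡ (ℚₚ.≤-trans (Rising.slope (rho-rising G) s u s≤u) steep)
  rho-steep⇒cool-≱′ G@(game L R) s t s<t steep (active _ j₀ cool≡ scores≡) p =
    let _ , rho≡ = scores≡ t ℚₚ.≤-refl
        j , q = rho~-steep⇒≥ G s t s<t j₀
          (subst₂ (λ x y → x - s ≤ y - t) (proj₂ (scores≡ s (ℚₚ.<⇒≤ s<t))) rho≡ steep) in
    ≥⇒⋫ ⌜ rho~ G t ⌝ (right (cool~ G t) j) q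
      (≥-right (cool~ G t) ⌜ rho~ G t ⌝ (subst₂ (λ x H → H ≥ᴳ ⌜ x ⌝) rho≡ cool≡ p) j)

  rho~-steep⇒≥ : ∀ G s t → s < t → RightOption G → rho~ G s - s ≤ rho~ G t - t →
    ∃ λ j → ⌜ rho~ G t ⌝ ≥ᴳ right (cool~ G t) j
  rho~-steep⇒≥ G@(game L R) s t s<t j₀ steep = let j , eq = rho~-selects G s j₀ in
    j , rho~-steep⇒≥-at G s t s<t steep j eq

  rho~-steep⇒≥-at : ∀ G s t → s < t → rho~ G s - s ≤ rho~ G t - t →
    ∀ j → rho~ G s ≡ lam (right G j) s + s → ⌜ rho~ G t ⌝ ≥ᴳ cool (right G j) t ⊕ ⌜ t ⌝
  rho~-steep⇒≥-at G@(game L R) s t s<t steep j eq =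
    ≥-⊕⌜⌝ (cool (R j) t) t (rho~ G t) (≥-trans ⌜ rho~ G t - t ⌝ ⌜ lam (R j) t ⌝ (cool (R j) t)
      (⌜⌝-mono (lam (R j) t) (rho~ G t - t)
        (ℚₚ.≤-trans (Falling.monotone (lam-falling (R j)) s t (ℚₚ.<⇒≤ s<t)) λs≤ρt))
      (lam-constant⇒≥-cool (R j) s t s<t (ℚₚ.≤-trans λs≤ρt
        (≤-move⁻¹ (value (rho~ G t)) (value (lam (R j) t)) (value t) (rho~-≤ G t j)))))
    where
    λs≤ρt : lam (R j) s ≤ rho~ G t - t
    λs≤ρt = ℚₚ.≤-trans
      (≤-moveʳ⁻¹ (value (lam (R j) s)) (value (rho~ G s)) (value s) (ℚₚ.≤-reflexive (cong value (sym eq)))) steep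

-- Slopes from strict monotonicity

lam~-falling : ∀ G → LeftOption G → ∃ λ n → Falling n (lam~ G)
lam~-falling (game L R) i₀ = _ ,
  Cooled.falling~ L R (λ i → thermograph (L i)) (λ j → thermograph (R j)) i₀

rho~-rising : ∀ G → RightOption G → ∃ λ n → Rising n (rho~ G)
rho~-rising (game L R) j₀ = _ ,
  Cooled.rising~ L R (λ i → thermograph (L i)) (λ j → thermograph (R j)) j₀

-1/2^-< : ∀ k t → t - 1/2^ k < t
-1/2^-< k t = <-shift (1/2^-pos k) (ring (value t) (value (1/2^ k)))
  where
  ring : ∀ t h → t ℚ.- h ℚ.- t ≡ 0ℚ ℚ.- h
  ring = RingSolver.solve-∀ ℚ-ring

1/2^-gap-< : ∀ k x y → exponent x ℕ.≤ k → exponent y ℕ.≤ k → x < y → 1/2^ k ≤ y - x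
1/2^-gap-< k x y ex ey x<y = 1/2^-gap k (y - x)
  (ℕₚ.≤-trans (exponent-+ y (- x)) (ℕₚ.⊔-lub ey ex)) (<-shift x<y (ring (value x) (value y)))
  where
  ring : ∀ x y → 0ℚ ℚ.- (y ℚ.- x) ≡ x ℚ.- y
  ring = RingSolver.solve-∀ ℚ-ring

-- Distinct points of the grid are a full step 2⁻ᵏ apart, so going back half a step from t stays
-- strictly to the right of a.
<-−1/2^ : ∀ k a t → exponent a ℕ.≤ k → exponent t ℕ.≤ k → a < t → a < t - 1/2^ (suc k)
<-−1/2^ k a t ea et a<t = <-shift h<t-a (ring₂ (value a) (value t) h)
  where
  h : ℚ
  h = value (1/2^ (suc k))
  ring₁ : ∀ h → h ℚ.- (h ℚ.+ h) ≡ 0ℚ ℚ.- h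
  ring₁ = RingSolver.solve-∀ ℚ-ring
  ring₂ : ∀ a t h → a ℚ.- (t ℚ.- h) ≡ h ℚ.- (t ℚ.- a)
  ring₂ = RingSolver.solve-∀ ℚ-ring
  h<t-a : h ℚ.< value t ℚ.- value a
  h<t-a = ℚₚ.<-≤-trans (<-shift {a = 0ℚ} {b = h} {c = h} {d = h ℚ.+ h} (1/2^-pos (suc k)) (ring₁ h))
    (subst (ℚ._≤ value t ℚ.- value a) (sym (1/2^-half k)) (1/2^-gap-< k a t ea et a<t))

-- A point s of the interval to the left of t, and on a grid so fine that functions of order n
-- with distinct values at s and t differ by at least t - s there.
record GridPoint (n : ℕ) (a b t : ℤ[½]) : Set where
  field
    s        : ℤ[½]
    s<t      : s < t
    inside   : InInterval a b s
    distinct : ∀ x y → exponent x ℕ.≤ n ℕ.⊔ exponent s → exponent y ℕ.≤ n ℕ.⊔ exponent t →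
      (x < y → t - s ≤ y - x) × (y < x → t - s ≤ x - y)

gridPoint : ∀ n a b t → InInterval a b t → GridPoint n a b t
gridPoint n a b t (a<t , t≤b) = record
  { s        = s
  ; s<t      = -1/2^-< k t
  ; inside   = <-−1/2^ (n ℕ.⊔ e) a t
      (ℕₚ.≤-trans (ℕₚ.m≤m⊔n (exponent a) (exponent t)) (ℕₚ.m≤n⊔m n e))
      (ℕₚ.≤-trans (ℕₚ.m≤n⊔m (exponent a) (exponent t)) (ℕₚ.m≤n⊔m n e)) a<t
    , ℚₚ.≤-trans (ℚₚ.<⇒≤ (-1/2^-< k t)) t≤b
  ; distinct = λ x y ex ey →
      let ex′ = ℕₚ.≤-trans ex (ℕₚ.⊔-lub n≤k s≤k) ; ey′ = ℕₚ.≤-trans ey (ℕₚ.⊔-lub n≤k t≤k) in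
      (λ x<y → subst (ℚ._≤ value y ℚ.- value x) (sym step) (1/2^-gap-< k x y ex′ ey′ x<y)) ,
      (λ y<x → subst (ℚ._≤ value x ℚ.- value y) (sym step) (1/2^-gap-< k y x ey′ ex′ y<x))
  }
  where
  e k : ℕ
  e = exponent a ℕ.⊔ exponent t
  -- The grid contains a and t and resolves order n; the extra halving keeps s strictly above a.
  k = suc (n ℕ.⊔ e)
  s : ℤ[½]
  s = t - 1/2^ k
  n≤k : n ℕ.≤ k
  n≤k = ℕₚ.m≤n⇒m≤1+n (ℕₚ.m≤m⊔n n e)
  t≤k : exponent t ℕ.≤ k
  t≤k = ℕₚ.m≤n⇒m≤1+n (ℕₚ.≤-trans (ℕₚ.m≤n⊔m (exponent a) (exponent t)) (ℕₚ.m≤n⊔m n e))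
  s≤k : exponent s ℕ.≤ k
  s≤k = ℕₚ.≤-trans (exponent-+ t (- 1/2^ k)) (ℕₚ.⊔-lub t≤k ℕₚ.≤-refl)
  step : value t ℚ.- value s ≡ value (1/2^ k)
  step = ring (value t) (value (1/2^ k))
    where
    ring : ∀ t h → t ℚ.- (t ℚ.- h) ≡ h
    ring = RingSolver.solve-∀ ℚ-ring

-- On the chosen grid a strict drop between s and t cannot be smaller than t - s, and this is the
-- endpoint form of slope -1.
lam~-decreasing-steep : ∀ {n} G a b t → Falling n (lam~ G) → StrictlyDecreasingOn (InInterval a b) (lam~ G) →
  InInterval a b t → ∃ λ s → s < t × lam~ G t + t ≤ lam~ G s + s
lam~-decreasing-steep {n} G a b t falling decreasing t∈I =
  s , s<t , ≤-shift (proj₂ (distinct (lam~ G s) (lam~ G t) (grid s) (grid t)) (decreasing s t inside t∈I s<t))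
    (ring (value (lam~ G s)) (value (lam~ G t)) (value s) (value t))
  where
  open GridPoint (gridPoint n a b t t∈I)
  open Falling falling
  ring : ∀ x y s t → y ℚ.+ t ℚ.- (x ℚ.+ s) ≡ t ℚ.- s ℚ.- (x ℚ.- y)
  ring = RingSolver.solve-∀ ℚ-ring

rho~-increasing-steep : ∀ {n} G a b t → Rising n (rho~ G) → StrictlyIncreasingOn (InInterval a b) (rho~ G) →
  InInterval a b t → ∃ λ s → s < t × rho~ G s - s ≤ rho~ G t - t
rho~-increasing-steep {n} G a b t rising increasing t∈I =
  s , s<t , ≤-shift (proj₁ (distinct (rho~ G s) (rho~ G t) (grid s) (grid t)) (increasing s t inside t∈I s<t))
    (ring (value (rho~ G s)) (value (rho~ G t)) (value s) (value t))
  where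
  open GridPoint (gridPoint n a b t t∈I)
  open Rising rising
  ring : ∀ x y s t → x ℚ.- s ℚ.- (y ℚ.- t) ≡ t ℚ.- s ℚ.- (y ℚ.- x)
  ring = RingSolver.solve-∀ ℚ-ring

lemma7 : ∀ (G : Game) → ¬ IsInteger G → ∀ (a b : ℤ[½]) → a < b →
    (ConstantOn (InInterval a b) (lam~ G) →
    ∀ t → InInterval a b t → ∀ (i : LeftOption G) →
    cool (left G i) t ⊖ ⌜ t ⌝ ⊲∣ ⌜ lam~ G t ⌝) ×
    (ConstantOn (InInterval a b) (rho~ G) →
    ∀ t → InInterval a b t → ∀ (j : RightOption G) →
    ⌜ rho~ G t ⌝ ⊲∣ cool (right G j) t ⊕ ⌜ t ⌝) ×
    (StrictlyDecreasingOn (InInterval a b) (lam~ G) →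
    ∀ t → InInterval a b t → ∃ λ (i : LeftOption G) →
    cool (left G i) t ⊖ ⌜ t ⌝ ≥ᴳ ⌜ lam~ G t ⌝) ×
    (StrictlyIncreasingOn (InInterval a b) (rho~ G) →
    ∀ t → InInterval a b t → ∃ λ (j : RightOption G) →
    ⌜ rho~ G t ⌝ ≥ᴳ cool (right G j) t ⊕ ⌜ t ⌝)
lemma7 G@(game L R) ¬int a b _ =
  -- Constancy asks for a single point of the interval to the left of t, so a grid of order 0
  -- serves.
  (λ constant t t∈I → let open GridPoint (gridPoint 0 a b t t∈I) in
    lam~-constant⇒⊲∣ G s t s<t (ℚₚ.≤-reflexive (cong value (constant s t inside t∈I)))) ,
  (λ constant t t∈I → let open GridPoint (gridPoint 0 a b t t∈I) in
    rho~-constant⇒⊲∣ G s t s<t (ℚₚ.≤-reflexive (cong value (constant t s t∈I inside)))) ,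
  (λ decreasing t t∈I →
    let s , s<t , steep = lam~-decreasing-steep G a b t (proj₂ (lam~-falling G i₀)) decreasing t∈I in
    lam~-steep⇒≥ G s t s<t i₀ steep) ,
  (λ increasing t t∈I →
    let s , s<t , steep = rho~-increasing-steep G a b t (proj₂ (rho~-rising G j₀)) increasing t∈I in
    rho~-steep⇒≥ G s t s<t j₀ steep)
  where
  i₀ : LeftOption G
  i₀ = leftOption G ¬int
  j₀ : RightOption G
  j₀ = rightOption G ¬int
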